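{- Let $(G,I)$ be a single interval mean-payoff game, i.e. $I$ is a single real interval. If Adam has a winning strategy then he has a positional winning strategy. If Eve has a winning strategy then she has a winning strategy that requires only finite memory.
   Context: A game graph is a tuple $G=(V,V_\exists,E,w,q_0)$ where $(V,E)$ is a finite directed graph in which every vertex has an outgoing edge, $w:E\to\mathbb{Z}$ is an integer edge-weight function, $V_\exists\subseteq V$ are Eve's vertices (the rest are Adam's), and $q_0\in V$ is the initial vertex. A play is an infinite path $\pi=v_0v_1\cdots$ with $v_0=q_0$; write $w(\pi[..k])=\sum_{i=0}^{k-1}w(v_i,v_{i+1})$. A strategy for a player maps finite play prefixes ending in one of that player's vertices to a successor vertex; it is positional if it depends only on the last vertex, and has finite memory if it can be realized as the output of a finite-state machine reading the play. The (liminf) mean-payoff is $\underline{MP}(\pi)=\liminf_{k\to\infty}\frac1k w(\pi[..k])$. A play is winning for Eve iff $\underline{MP}(\pi)\in I$, and winning for Adam otherwise; a strategy is winning for a player if every play consistent with it is winning for that player.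
   Formalization: The claim about Eve is proved under the added assumption that if I is a single point then that point is rational; for I = {α} with α irrational Eve may win but never with finite memory. The claim about Adam is for every real interval. -}

module Defs where

open import Data.Bool.Base using (Bool; true; false; T)
open import Data.Fin.Base using (Fin)
open import Data.Integer.Base as ℤ using (ℤ)
open import Data.Nat.Base as ℕ using (ℕ; zero; suc)
open import Data.Product.Base using (Σ-syntax; ∃-syntax; _×_; _,_; proj₁)
open import Data.Rational.Base as ℚ using (ℚ; 1ℚ)
open import Data.Rational.Properties as ℚₚ using (<-dense; <-trans; <-asym; <-cmp)
open import Data.Sum.Base using (_⊎_; inj₁; inj₂)
open import Data.Unit.Base using (⊤)
open import Relation.Binary.Definitions using (tri<; tri≈; tri>)
open import Relation.Binary.PropositionalEquality using (_≡_; refl; subst)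
open import Relation.Nullary using (¬_)

-- Two-sided Dedekind cuts: lower q means q < x, upper q means x < q.
record ℝ : Set₁ where
  field
    lower upper     : ℚ → Set
    lower-inhabited : ∃[ q ] lower q
    upper-inhabited : ∃[ q ] upper q
    lower-closed    : ∀ {p q} → p ℚ.< q → lower q → lower p
    upper-closed    : ∀ {p q} → p ℚ.< q → upper p → upper q
    lower-rounded   : ∀ {p} → lower p → ∃[ q ] (p ℚ.< q × lower q)
    upper-rounded   : ∀ {q} → upper q → ∃[ p ] (p ℚ.< q × upper p)
    disjoint        : ∀ {q} → ¬ (lower q × upper q)
    located         : ∀ {p q} → p ℚ.< q → lower p ⊎ upper q

open ℝ public

infix 4 _≤_ _<_ _≈_

_≤_ _<_ _≈_ : ℝ → ℝ → Set
x ≤ y = ∀ q → lower x q → lower y q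
x < y = ∃[ q ] (upper x q × lower y q)
x ≈ y = x ≤ y × y ≤ x

private
  p-1<p : ∀ p → p ℚ.- 1ℚ ℚ.< p
  p-1<p p = subst (p ℚ.- 1ℚ ℚ.<_) (ℚₚ.+-identityʳ p)
    (ℚₚ.+-monoʳ-< p (ℚₚ.negative⁻¹ (ℚ.- 1ℚ)))

  p<p+1 : ∀ p → p ℚ.< p ℚ.+ 1ℚ
  p<p+1 p = subst (ℚ._< p ℚ.+ 1ℚ) (ℚₚ.+-identityʳ p)
    (ℚₚ.+-monoʳ-< p (ℚₚ.positive⁻¹ 1ℚ))

  ℚ-located : ∀ r {p q} → p ℚ.< q → p ℚ.< r ⊎ r ℚ.< q
  ℚ-located r {p} {q} p<q with <-cmp p r
  ... | tri< p<r _ _ = inj₁ p<r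
  ... | tri≈ _ refl _ = inj₂ p<q
  ... | tri> _ _ r<p = inj₂ (<-trans r<p p<q)

fromℚ : ℚ → ℝ
fromℚ r = record
  { lower           = ℚ._< r
  ; upper           = r ℚ.<_
  ; lower-inhabited = r ℚ.- 1ℚ , p-1<p r
  ; upper-inhabited = r ℚ.+ 1ℚ , p<p+1 r
  ; lower-closed    = <-trans
  ; upper-closed    = λ p<q r<p → <-trans r<p p<q
  ; lower-rounded   = <-dense
  ; upper-rounded   = λ r<q → let (m , r<m , m<q) = <-dense r<q in m , m<q , r<m
  ; disjoint        = λ (q<r , r<q) → <-asym q<r r<q
  ; located         = ℚ-located r
  }

IsInfimum : (ℕ → ℝ) → ℝ → Set₁
IsInfimum a x = (∀ k → x ≤ a k) × (∀ y → (∀ k → y ≤ a k) → y ≤ x)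

IsSupremum : (ℕ → ℝ) → ℝ → Set₁
IsSupremum a x = (∀ k → a k ≤ x) × (∀ y → (∀ k → a k ≤ y) → x ≤ y)

-- x = supₙ inf_{k ≥ n} a k, where m n is the inner infimum.
IsLiminf : (ℕ → ℝ) → ℝ → Set₁
IsLiminf a x = Σ[ m ∈ (ℕ → ℝ) ]
  ((∀ n → IsInfimum (λ k → a (n ℕ.+ k)) (m n)) × IsSupremum m x)

data Endpoint : Set₁ where
  infinite  : Endpoint
  inclusive : ℝ → Endpoint
  exclusive : ℝ → Endpoint

record Interval : Set₁ where
  field
    left right : Endpoint

RightOf : Endpoint → ℝ → Set
RightOf infinite      x = ⊤
RightOf (inclusive a) x = a ≤ x
RightOf (exclusive a) x = a < x

LeftOf : Endpoint → ℝ → Set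
LeftOf infinite      x = ⊤
LeftOf (inclusive b) x = x ≤ b
LeftOf (exclusive b) x = x < b

infix 4 _∈ᴵ_

_∈ᴵ_ : ℝ → Interval → Set
x ∈ᴵ I = RightOf (Interval.left I) x × LeftOf (Interval.right I) x

-- If I consists of a single point, that point is rational.  This holds in
-- particular whenever I is empty, or non-degenerate, or has rational endpoints.
-- Eve can need infinite memory for I = {α} with α irrational: let her alone
-- choose, at every step, between weights 0 and 1, with 0 < α < 1.
NotIrrationalPoint : Interval → Set₁
NotIrrationalPoint I = ∀ x → x ∈ᴵ I → (∀ y → y ∈ᴵ I → y ≈ x) → ∃[ q ] x ≈ fromℚ q

data Player : Set where
  eve adam : Player

record GameGraph : Set where
  field
    order : ℕ

  V : Set
  V = Fin order

  field
    V∃ : V → Bool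
    E  : V → V → Bool

  Edge : V → V → Set
  Edge u v = T (E u v)

  field
    total : ∀ u → ∃[ v ] Edge u v
    w     : ∀ {u v} → Edge u v → ℤ
    q₀    : V

module _ (G : GameGraph) where
  open GameGraph G

  Owns : Player → V → Set
  Owns eve  v = V∃ v ≡ true
  Owns adam v = V∃ v ≡ false

  -- Finite play prefixes, indexed by their last vertex.
  data Prefix : V → Set where
    start : ∀ {v} → v ≡ q₀ → Prefix v
    _▷_   : ∀ {u v} → Prefix u → Edge u v → Prefix v

  record Play : Set where
    field
      vertex : ℕ → V
      starts : vertex 0 ≡ q₀
      step   : ∀ i → Edge (vertex i) (vertex (suc i))

  open Play

  prefix : (π : Play) (k : ℕ) → Prefix (vertex π k)
  prefix π zero    = start (starts π)
  prefix π (suc k) = prefix π k ▷ step π k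

  weight : Play → ℕ → ℤ
  weight π zero    = ℤ.0ℤ
  weight π (suc k) = weight π k ℤ.+ w (step π k)

  -- The averages are indexed from k = 1, so entry k is w(π[..k+1]) / (k+1).
  average : Play → ℕ → ℚ
  average π k = weight π (suc k) ℚ./ suc k

  IsMeanPayoff : Play → ℝ → Set₁
  IsMeanPayoff π x = IsLiminf (λ k → fromℚ (average π k)) x

  Strategy : Player → Set
  Strategy p = ∀ {v} → Prefix v → Owns p v → Σ[ u ∈ V ] Edge v u

  Consistent : ∀ {p} → Strategy p → Play → Set
  Consistent {p} σ π = ∀ k (o : Owns p (vertex π k)) →
    vertex π (suc k) ≡ proj₁ (σ (prefix π k) o)

  Positional : ∀ {p} → Strategy p → Set
  Positional {p} σ = Σ[ f ∈ (V → V) ]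
    (∀ {v} (h : Prefix v) (o : Owns p v) → proj₁ (σ h o) ≡ f v)

  record Machine : Set where
    field
      size    : ℕ
      initial : Fin size
      update  : Fin size → V → Fin size
      output  : Fin size → V

  -- The state after reading every vertex of the prefix, the last one included.
  run : (M : Machine) → ∀ {v} → Prefix v → Fin (Machine.size M)
  run M {v} (start _) = Machine.update M (Machine.initial M) v
  run M {v} (h ▷ _)   = Machine.update M (run M h) v

  FiniteMemory : ∀ {p} → Strategy p → Set
  FiniteMemory {p} σ = Σ[ M ∈ Machine ]
    (∀ {v} (h : Prefix v) (o : Owns p v) → proj₁ (σ h o) ≡ Machine.output M (run M h))

  module _ (I : Interval) where

    WonBy : Player → Play → Set₁
    WonBy eve  π = Σ[ x ∈ ℝ ] (IsMeanPayoff π x × x ∈ᴵ I)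
    WonBy adam π = ¬ WonBy eve π

    Winning : ∀ {p} → Strategy p → Set₁
    Winning {p} σ = ∀ π → Consistent {p} σ π → WonBy p π

{-# OPTIONS --safe #-}
module Submission where

-- Suppose no positional strategy of Adam wins.  Then Eve has a controller under which
-- a k - C ≤ W ≤ b k + C for all finite plays of length k and weight W, with a and b in I and a
-- constant C; this puts the mean-payoff in [a , b].  The proof is by induction on the set of moves
-- left to Adam.
--
-- If Adam can choose between u₁ and u₂ at v, Eve has a controller for each of the two games in which
-- one of these moves is deleted.  She cuts the play at its visits to v and gives every excursion from
-- v to the controller that allows it.  The play is then a shuffle of two controlled plays, and the
-- bounds add up.  (For liminf alone this would fail: the bound W ≤ b k + C, stronger than liminf ≤ b,
-- is essential.)
--
-- If Adam has no choice left, his only strategy loses, so some play has its mean-payoff x in I.  It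
-- visits some vertex v infinitely often, and the strongly connected component of v contains a cycle of
-- mean μ ≤ x and one of mean ν ≥ x: if all its short cycles had mean at least q > x, then so would all
-- its closed walks, and the play would have weight at least q k - C.  Eve repeats one of these cycles
-- if its mean is in I.  Otherwise μ < x < ν, and she combines the two cycles: into a closed walk whose
-- mean is a rational point of I, or, when I = {x} with x irrational, greedily so as to stay near x k.

open import Axiom.ExcludedMiddle using (ExcludedMiddle)
open import Axiom.UniquenessOfIdentityProofs using (module Decidable⇒UIP)
open import Data.Bool.Base using (true; false)
import Data.Bool.Properties as Boolₚ
open import Data.Fin.Base as Fin using (Fin; toℕ; fromℕ<; inject≤; combine)
import Data.Fin.Properties as Finₚ
open import Data.Fin.Subset using (Subset; _∈_; _⊂_) renaming (_-_ to _∖_; ⊤ to full)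
open import Data.Fin.Subset.Induction using (⊂-wellFounded)
open import Data.Fin.Subset.Properties using (x∈p⇒p-x⊂p; x∈p∧x≢y⇒x∈p-y; ∈⊤)
open import Data.Integer.Base as ℤ using (ℤ)
import Data.Integer.Properties as ℤₚ
import Data.Integer.Tactic.RingSolver as ℤ-Solver
open import Data.Nat.Base as ℕ using (ℕ; zero; suc)
open import Data.Nat.Induction using (<-wellFounded)
import Data.Nat.Properties as ℕₚ
open import Data.Product.Base using (Σ-syntax; ∃-syntax; _×_; _,_; proj₁; proj₂)
open import Data.Product.Function.NonDependent.Propositional using (_×-↪_)
open import Data.Rational.Base as ℚ using (ℚ; 0ℚ; 1ℚ; ↥_; ↧ₙ_; _+_; _*_; _-_; -_; _÷_)
open import Data.Rational.Literals using (fromℤ)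
import Data.Rational.Properties as ℚₚ
open import Algebra.Properties.Group ℚₚ.+-0-group
  using (x∙y⁻¹≈ε⇒x≈y; //-rightDividesˡ) renaming (⁻¹-involutive to neg-involutive)
import Data.Rational.Unnormalised.Base as ℚᵘ
import Data.Rational.Unnormalised.Properties as ℚᵘₚ
open import Data.Sum.Base using (_⊎_; inj₁; inj₂; swap)
open import Data.Sum.Function.Propositional using (_⊎-↪_)
open import Data.Unit.Base using (⊤; tt)
open import Function.Base using (_∘_; id)
open import Function.Bundles using (_↪_; RightInverse)
open import Function.Construct.Composition using (_↪-∘_)
open import Function.Construct.Identity using (↪-id)
open import Function.Construct.Symmetry using (↔-sym)
open import Function.Properties.Inverse using (↔⇒↪)
open import Induction.WellFounded using (Acc; acc)
open import Level using (0ℓ; Lift; lift) renaming (suc to lsuc; lower to unlift)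
open import Relation.Binary.Construct.Closure.ReflexiveTransitive using (Star; ε; _◅_; _◅◅_)
open import Relation.Binary.Definitions using (_Respects_; tri<; tri≈; tri>)
open import Relation.Binary.PropositionalEquality
  using (_≡_; _≢_; refl; sym; trans; cong; cong₂; subst; subst₂; module ≡-Reasoning)
open import Relation.Nullary using (¬_; Dec; yes; no; contradiction)
open import Relation.Nullary.Decidable using (dec⇒maybe; map′; decidable-stable)
open import Tactic.RingSolver using (solve-∀)
open import Tactic.RingSolver.Core.AlmostCommutativeRing
  using (AlmostCommutativeRing; fromCommutativeRing)
open import Defs

open Decidable⇒UIP Boolₚ._≟_ using (≡-irrelevant)

-- Rational arithmetic

ℚ-ring : AlmostCommutativeRing 0ℓ 0ℓ
ℚ-ring = fromCommutativeRing ℚₚ.+-*-commutativeRing (λ p → dec⇒maybe (0ℚ ℚₚ.≟ p))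

p<-q⇒q<-p : ∀ {p q} → p ℚ.< - q → q ℚ.< - p
p<-q⇒q<-p {p} {q} p<-q = subst (ℚ._< - p) (neg-involutive q) (ℚₚ.neg-antimono-< p<-q)

-p<q⇒-q<p : ∀ {p q} → - p ℚ.< q → - q ℚ.< p
-p<q⇒-q<p {p} {q} -p<q = subst (- q ℚ.<_) (neg-involutive p) (ℚₚ.neg-antimono-< -p<q)

p≤q⇒0≤q-p : ∀ {p q} → p ℚ.≤ q → 0ℚ ℚ.≤ q - p
p≤q⇒0≤q-p {p} {q} p≤q = subst (ℚ._≤ q - p) (ℚₚ.+-inverseʳ p) (ℚₚ.+-monoˡ-≤ (- p) p≤q)

p<q⇒0<q-p : ∀ {p q} → p ℚ.< q → 0ℚ ℚ.< q - p
p<q⇒0<q-p {p} {q} p<q = subst (ℚ._< q - p) (ℚₚ.+-inverseʳ p) (ℚₚ.+-monoˡ-< (- p) p<q)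

0≤q-p⇒p≤q : ∀ {p q} → 0ℚ ℚ.≤ q - p → p ℚ.≤ q
0≤q-p⇒p≤q {p} {q} 0≤q-p = subst₂ ℚ._≤_ (ℚₚ.+-identityˡ p) (//-rightDividesˡ p q) (ℚₚ.+-monoˡ-≤ p 0≤q-p)

p-q≤0⇒p≤q : ∀ {p q} → p - q ℚ.≤ 0ℚ → p ℚ.≤ q
p-q≤0⇒p≤q {p} {q} p-q≤0 = subst₂ ℚ._≤_ (//-rightDividesˡ q p) (ℚₚ.+-identityˡ q) (ℚₚ.+-monoˡ-≤ q p-q≤0)

neg-*-antimono-≤ : ∀ {W} p k → W ℚ.≤ p * k → - p * k ℚ.≤ - W
neg-*-antimono-≤ {W} p k W≤pk = subst (ℚ._≤ - W) (ℚₚ.neg-distribˡ-* p k) (ℚₚ.neg-antimono-≤ W≤pk)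

neg-*-cancel-≤ : ∀ {W} p k → - p * k ℚ.≤ - W → W ℚ.≤ p * k
neg-*-cancel-≤ {W} p k -pk≤-W =
  subst₂ ℚ._≤_ (neg-involutive W) (double-neg p k) (ℚₚ.neg-antimono-≤ -pk≤-W)
  where
  double-neg : ∀ p k → - (- p * k) ≡ p * k
  double-neg = solve-∀ ℚ-ring

÷-*-cancel : ∀ p q .{{_ : ℚ.NonZero q}} → (p ÷ q) * q ≡ p
÷-*-cancel p q = begin
  p * ℚ.1/ q * q    ≡⟨ ℚₚ.*-assoc p (ℚ.1/ q) q ⟩
  p * (ℚ.1/ q * q)  ≡⟨ cong (p *_) (ℚₚ.*-inverseˡ q) ⟩
  p * 1ℚ            ≡⟨ ℚₚ.*-identityʳ p ⟩
  p                 ∎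
  where open ≡-Reasoning

fromℤ-+ : ∀ i j → fromℤ (i ℤ.+ j) ≡ fromℤ i + fromℤ j
fromℤ-+ i j = ℚₚ.toℚᵘ-injective
  (ℚᵘₚ.≃-trans (ℚᵘ.*≡* (same-numerator i j)) (ℚᵘₚ.≃-sym (ℚₚ.toℚᵘ-homo-+ (fromℤ i) (fromℤ j))))
  where
  same-numerator : ∀ i j → (i ℤ.+ j) ℤ.* (ℤ.1ℤ ℤ.* ℤ.1ℤ) ≡ (i ℤ.* ℤ.1ℤ ℤ.+ j ℤ.* ℤ.1ℤ) ℤ.* ℤ.1ℤ
  same-numerator = ℤ-Solver.solve-∀

fromℕ : ℕ → ℚ
fromℕ n = fromℤ (ℤ.+ n)

fromℕ-+ : ∀ m n → fromℕ (m ℕ.+ n) ≡ fromℕ m + fromℕ n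
fromℕ-+ m n = fromℤ-+ (ℤ.+ m) (ℤ.+ n)

fromℕ-mono-≤ : ∀ {m n} → m ℕ.≤ n → fromℕ m ℚ.≤ fromℕ n
fromℕ-mono-≤ m≤n = ℚ.*≤* (ℤₚ.*-monoʳ-≤-nonNeg ℤ.1ℤ (ℤ.+≤+ m≤n))

fromℕ-mono-< : ∀ {m n} → m ℕ.< n → fromℕ m ℚ.< fromℕ n
fromℕ-mono-< m<n = ℚ.*<* (ℤₚ.*-monoʳ-<-pos ℤ.1ℤ (ℤ.+<+ m<n))

/-*-cancel : ∀ i n .{{_ : ℕ.NonZero n}} → (i ℚ./ n) * fromℕ n ≡ fromℤ i
/-*-cancel i n@(suc n-1) = ℚₚ.toℚᵘ-injective (begin
  ℚ.toℚᵘ ((i ℚ./ n) * fromℕ n)            ≈⟨ ℚₚ.toℚᵘ-homo-* (i ℚ./ n) (fromℕ n) ⟩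
  ℚ.toℚᵘ (i ℚ./ n) ℚᵘ.* ℚ.toℚᵘ (fromℕ n)  ≈⟨ ℚᵘₚ.*-congʳ (ℚₚ.toℚᵘ-fromℚᵘ (ℚᵘ.mkℚᵘ i n-1)) ⟩
  ℚᵘ.mkℚᵘ i n-1 ℚᵘ.* ℚ.toℚᵘ (fromℕ n)     ≈⟨ ℚᵘ.*≡* (same-numerator i (ℤ.+ n)) ⟩
  ℚ.toℚᵘ (fromℤ i)                         ∎)
  where
  open ℚᵘₚ.≃-Reasoning
  same-numerator : ∀ i j → i ℤ.* j ℤ.* ℤ.1ℤ ≡ i ℤ.* (j ℤ.* ℤ.1ℤ)
  same-numerator = ℤ-Solver.solve-∀

p*↧p≡↥p : ∀ p → p * fromℕ (↧ₙ p) ≡ fromℤ (↥ p)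
p*↧p≡↥p p = subst (λ q → q * fromℕ (↧ₙ p) ≡ fromℤ (↥ p)) (ℚₚ.↥p/↧p≡p p) (/-*-cancel (↥ p) (↧ₙ p))

<-fromℕ : ∀ p → ∃[ n ] p ℚ.< fromℕ n
<-fromℕ p = suc ℤ.∣ ↥ p ∣ , ℚ.*<* (begin-strict
  ↥ p ℤ.* ℤ.1ℤ                    ≡⟨ ℤₚ.*-identityʳ (↥ p) ⟩
  ↥ p                             ≤⟨ i≤∣i∣ (↥ p) ⟩
  ℤ.+ ℤ.∣ ↥ p ∣                   <⟨ ℤ.+<+ (ℕₚ.n<1+n _) ⟩
  ℤ.+ suc ℤ.∣ ↥ p ∣               ≤⟨ ℤ.+≤+ (ℕₚ.m≤m*n (suc ℤ.∣ ↥ p ∣) (↧ₙ p)) ⟩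
  ℤ.+ (suc ℤ.∣ ↥ p ∣ ℕ.* ↧ₙ p)    ≡⟨ ℤₚ.pos-* (suc ℤ.∣ ↥ p ∣) (↧ₙ p) ⟩
  ℤ.+ suc ℤ.∣ ↥ p ∣ ℤ.* ℚ.↧ p     ∎)
  where
  open ℤₚ.≤-Reasoning
  i≤∣i∣ : ∀ i → i ℤ.≤ ℤ.+ ℤ.∣ i ∣
  i≤∣i∣ (ℤ.+ n)    = ℤₚ.≤-refl
  i≤∣i∣ ℤ.-[1+ n ] = ℤ.-≤+

archimedean : ∀ {d} → 0ℚ ℚ.< d → ∀ p → ∃[ n ] p ℚ.< fromℕ n * d
archimedean {d} 0<d p = let (n , p/d<n) = <-fromℕ (p ÷ d) in
  n , subst (ℚ._< fromℕ n * d) (÷-*-cancel p d) (ℚₚ.*-monoˡ-<-pos d p/d<n)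
  where
  instance
    d-positive : ℚ.Positive d
    d-positive = ℚ.positive 0<d
    d-nonZero : ℚ.NonZero d
    d-nonZero = ℚ.>-nonZero 0<d

commensurable : ∀ {p q} → 0ℚ ℚ.< p → 0ℚ ℚ.< q → ∃[ m ] ∃[ n ] (fromℕ (suc m) * p ≡ fromℕ (suc n) * q)
commensurable {p} {q} 0<p 0<q =
  multiples (p ÷ q) {{ℚₚ.pos*pos⇒pos p (ℚ.1/ q) {{ℚₚ.1/pos⇒pos q}}}} (÷-*-cancel p q)
  where
  instance
    p-positive : ℚ.Positive p
    p-positive = ℚ.positive 0<p
    q-positive : ℚ.Positive q
    q-positive = ℚ.positive 0<q
    q-nonZero : ℚ.NonZero q
    q-nonZero = ℚₚ.pos⇒nonZero q

  multiples : ∀ t .{{_ : ℚ.Positive t}} → t * q ≡ p →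
    ∃[ m ] ∃[ n ] (fromℕ (suc m) * p ≡ fromℕ (suc n) * q)
  multiples t@(ℚ.mkℚ ℤ.+[1+ n ] m _) t*q≡p = m , n , (begin
    fromℕ (suc m) * p        ≡⟨ cong (fromℕ (suc m) *_) t*q≡p ⟨
    fromℕ (suc m) * (t * q)  ≡⟨ rearrange (fromℕ (suc m)) t q ⟩
    t * fromℕ (suc m) * q    ≡⟨ cong (_* q) (p*↧p≡↥p t) ⟩
    fromℕ (suc n) * q        ∎)
    where
    open ≡-Reasoning
    rearrange : ∀ a t q → a * (t * q) ≡ t * a * q
    rearrange = solve-∀ ℚ-ring

-- Dedekind cuts

lower<upper : ∀ x {p q} → lower x p → upper x q → p ℚ.< q
lower<upper x {p} {q} lp uq with ℚₚ.<-cmp p q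
... | tri< p<q _ _  = p<q
... | tri≈ _ refl _ = contradiction (lp , uq) (disjoint x)
... | tri> _ _ q<p  = contradiction (lower-closed x q<p lp , uq) (disjoint x)

upper-antitone : ∀ x y → x ≤ y → ∀ {q} → upper y q → upper x q
upper-antitone x y x≤y uq with upper-rounded y uq
... | p , p<q , up with located x p<q
...   | inj₁ lp  = contradiction (x≤y p lp , up) (disjoint y)
...   | inj₂ uq′ = uq′

<⇒≤ : ∀ x y → x < y → x ≤ y
<⇒≤ x y (q , ux , ly) p lp = lower-closed y (lower<upper x lp ux) ly

fromℚ-mono-≤ : ∀ {p q} → p ℚ.≤ q → fromℚ p ≤ fromℚ q
fromℚ-mono-≤ p≤q r r<p = ℚₚ.<-≤-trans r<p p≤q

fromℚ-≤ : ∀ x {q} → lower x q → fromℚ q ≤ x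
fromℚ-≤ x lq p p<q = lower-closed x p<q lq

≤-fromℚ : ∀ x {q} → upper x q → x ≤ fromℚ q
≤-fromℚ x uq p lp = lower<upper x lp uq

upper⇒≰ : ∀ x {q} → upper x q → ¬ (fromℚ q ≤ x)
upper⇒≰ x uq q≤x with upper-rounded x uq
... | p , p<q , up = disjoint x (q≤x p p<q , up)

lower⇒≱ : ∀ x {q} → lower x q → ¬ (x ≤ fromℚ q)
lower⇒≱ x lq x≤q = ℚₚ.<-irrefl refl (x≤q _ lq)

neg : ℝ → ℝ
lower (neg x) q = upper x (- q)
upper (neg x) q = lower x (- q)
lower-inhabited (neg x) with upper-inhabited x
... | q , uq = - q , subst (upper x) (sym (neg-involutive q)) uq
upper-inhabited (neg x) with lower-inhabited x
... | q , lq = - q , subst (lower x) (sym (neg-involutive q)) lq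
lower-closed (neg x) p<q = upper-closed x (ℚₚ.neg-antimono-< p<q)
upper-closed (neg x) p<q = lower-closed x (ℚₚ.neg-antimono-< p<q)
lower-rounded (neg x) up with upper-rounded x up
... | q , q<-p , uq = - q , p<-q⇒q<-p q<-p , subst (upper x) (sym (neg-involutive q)) uq
upper-rounded (neg x) lp with lower-rounded x lp
... | q , -p<q , lq = - q , -p<q⇒-q<p -p<q , subst (lower x) (sym (neg-involutive q)) lq
disjoint (neg x) (uq , lq) = disjoint x (lq , uq)
located (neg x) p<q = swap (located x (ℚₚ.neg-antimono-< p<q))

neg-antitone : ∀ x y → x ≤ y → neg y ≤ neg x
neg-antitone x y x≤y q = upper-antitone x y x≤y

∈ᴵ-convex : ∀ {a x b} I → a ∈ᴵ I → b ∈ᴵ I → a ≤ x → x ≤ b → x ∈ᴵ I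
∈ᴵ-convex {a} {x} {b} I (a∈ , _) (_ , b∈) a≤x x≤b =
  right-of (Interval.left I) a∈ , left-of (Interval.right I) b∈
  where
  right-of : ∀ e → RightOf e a → RightOf e x
  right-of infinite      _            = tt
  right-of (inclusive l) l≤a          = λ q → a≤x q ∘ l≤a q
  right-of (exclusive l) (q , u , lq) = q , u , a≤x q lq

  left-of : ∀ e → LeftOf e b → LeftOf e x
  left-of infinite      _            = tt
  left-of (inclusive r) b≤r          = λ q → b≤r q ∘ x≤b q
  left-of (exclusive r) (q , u , lq) = q , upper-antitone x b x≤b u , lq

-- Linear bounds on the weight of a play

-- a · k ≤ W + C
record Above (a : ℝ) (C : ℚ) (k : ℕ) (W : ℚ) : Set where
  constructor above
  field
    bound-at : ∀ {r} → lower a r → r * fromℕ k ℚ.≤ W + C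

open Above public

-- W ≤ b · k + C
Below : ℝ → ℚ → ℕ → ℚ → Set
Below b C k W = Above (neg b) C k (- W)

record Within (a b : ℝ) (C : ℚ) (k : ℕ) (W : ℚ) : Set where
  constructor _,_
  field
    is-above : Above a C k W
    is-below : Below b C k W

open Within public

*-fromℕ-monoˡ-≤ : ∀ {p q} k → p ℚ.≤ q → p * fromℕ k ℚ.≤ q * fromℕ k
*-fromℕ-monoˡ-≤ k = ℚₚ.*-monoʳ-≤-nonNeg (fromℕ k)

above-fromℚ : ∀ {q C k W} → q * fromℕ k ℚ.≤ W + C → Above (fromℚ q) C k W
above-fromℚ {k = k} qk≤W+C = above λ r<q → ℚₚ.≤-trans (*-fromℕ-monoˡ-≤ k (ℚₚ.<⇒≤ r<q)) qk≤W+C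

above-antitone : ∀ {a a′ C k W} → a′ ≤ a → Above a C k W → Above a′ C k W
above-antitone a′≤a h = above λ l → bound-at h (a′≤a _ l)

below-fromℚ : ∀ {q C k W} → W ℚ.≤ q * fromℕ k + C → Below (fromℚ q) C k W
below-fromℚ {q} {C} {k} {W} W≤qk+C = above-antitone {fromℚ (- q)} (λ _ → p<-q⇒q<-p) (above-fromℚ (begin
  - q * fromℕ k               ≡⟨ insert q (fromℕ k) C ⟩
  - (q * fromℕ k + C) + C     ≤⟨ ℚₚ.+-monoˡ-≤ C (ℚₚ.neg-antimono-≤ W≤qk+C) ⟩
  - W + C                     ∎))
  where
  open ℚₚ.≤-Reasoning
  insert : ∀ q k C → - q * k ≡ - (q * k + C) + C
  insert = solve-∀ ℚ-ring

above₀-fromℚ : ∀ {q k W} → q * fromℕ k ℚ.≤ W → Above (fromℚ q) 0ℚ k W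
above₀-fromℚ {q} {k} {W} = above-fromℚ {q} ∘ subst (q * fromℕ k ℚ.≤_) (sym (ℚₚ.+-identityʳ W))

below₀-fromℚ : ∀ {q k W} → W ℚ.≤ q * fromℕ k → Below (fromℚ q) 0ℚ k W
below₀-fromℚ {q} {k} {W} = below-fromℚ {q} ∘ subst (W ℚ.≤_) (sym (ℚₚ.+-identityʳ (q * fromℕ k)))

absorb-constant : ∀ r d k {C W} → r * fromℕ k ℚ.≤ W + C → C ℚ.≤ d * fromℕ k → (r - d) * fromℕ k ℚ.≤ W
absorb-constant r d k {C} {W} rk≤W+C C≤dk = begin
  (r - d) * fromℕ k            ≡⟨ distrib r d (fromℕ k) ⟩
  r * fromℕ k - d * fromℕ k    ≤⟨ ℚₚ.+-mono-≤ rk≤W+C (ℚₚ.neg-antimono-≤ C≤dk) ⟩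
  W + C - C                    ≡⟨ cancel W C ⟩
  W                            ∎
  where
  open ℚₚ.≤-Reasoning
  distrib : ∀ r d k → (r - d) * k ≡ r * k - d * k
  distrib = solve-∀ ℚ-ring
  cancel : ∀ W C → W + C - C ≡ W
  cancel = solve-∀ ℚ-ring

module _ {a : ℝ} where

  above-weaken : ∀ {C C′ k W} → C ℚ.≤ C′ → Above a C k W → Above a C′ k W
  above-weaken {W = W} C≤C′ h = above λ l → ℚₚ.≤-trans (bound-at h l) (ℚₚ.+-monoʳ-≤ W C≤C′)

  above-+ : ∀ {C C′ k k′ W W′} → Above a C k W → Above a C′ k′ W′ → Above a (C + C′) (k ℕ.+ k′) (W + W′)
  above-+ {C} {C′} {k} {k′} {W} {W′} h h′ = above λ {r} l → begin
    r * fromℕ (k ℕ.+ k′)         ≡⟨ cong (r *_) (fromℕ-+ k k′) ⟩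
    r * (fromℕ k + fromℕ k′)     ≡⟨ ℚₚ.*-distribˡ-+ r (fromℕ k) (fromℕ k′) ⟩
    r * fromℕ k + r * fromℕ k′   ≤⟨ ℚₚ.+-mono-≤ (bound-at h l) (bound-at h′ l) ⟩
    (W + C) + (W′ + C′)          ≡⟨ interchange W C W′ C′ ⟩
    (W + W′) + (C + C′)          ∎
    where
    open ℚₚ.≤-Reasoning
    interchange : ∀ W C W′ C′ → (W + C) + (W′ + C′) ≡ (W + W′) + (C + C′)
    interchange = solve-∀ ℚ-ring

  above-exists : ∀ k W → ∃[ C ] Above a C k W
  above-exists k W with upper-inhabited a
  ... | q , u = q * fromℕ k - W ,
    above-antitone (≤-fromℚ a u) (above-fromℚ (ℚₚ.≤-reflexive (cancel W (q * fromℕ k))))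
    where
    cancel : ∀ W y → y ≡ W + (y - W)
    cancel = solve-∀ ℚ-ring

  above-cancel : ∀ k₀ W₀ → ∃[ D ] (∀ {C k W} → Above a C (k₀ ℕ.+ k) (W₀ + W) → Above a (C + D) k W)
  above-cancel k₀ W₀ with lower-inhabited a
  ... | r₀ , l₀ = W₀ - r₀ * fromℕ k₀ , λ h → above (cancelled h)
    where
    open ℚₚ.≤-Reasoning

    expand : ∀ r k₀ k → r * k ≡ r * (k₀ + k) - r * k₀
    expand = solve-∀ ℚ-ring
    regroup : ∀ W₀ W C y → W₀ + W + C - y ≡ W + (C + (W₀ - y))
    regroup = solve-∀ ℚ-ring

    module _ {C k W} (h : Above a C (k₀ ℕ.+ k) (W₀ + W)) where

      cancelled-from-r₀ : ∀ {r} → lower a r → r₀ ℚ.≤ r → r * fromℕ k ℚ.≤ W + (C + (W₀ - r₀ * fromℕ k₀))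
      cancelled-from-r₀ {r} l r₀≤r = begin
        r * fromℕ k
          ≡⟨ expand r (fromℕ k₀) (fromℕ k) ⟩
        r * (fromℕ k₀ + fromℕ k) - r * fromℕ k₀
          ≡⟨ cong (λ m → r * m - r * fromℕ k₀) (fromℕ-+ k₀ k) ⟨
        r * fromℕ (k₀ ℕ.+ k) - r * fromℕ k₀
          ≤⟨ ℚₚ.+-mono-≤ (bound-at h l) (ℚₚ.neg-antimono-≤ (*-fromℕ-monoˡ-≤ k₀ r₀≤r)) ⟩
        W₀ + W + C - r₀ * fromℕ k₀
          ≡⟨ regroup W₀ W C (r₀ * fromℕ k₀) ⟩
        W + (C + (W₀ - r₀ * fromℕ k₀)) ∎

      cancelled : ∀ {r} → lower a r → r * fromℕ k ℚ.≤ W + (C + (W₀ - r₀ * fromℕ k₀))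
      cancelled {r} l with ℚₚ.≤-total r₀ r
      ... | inj₁ r₀≤r = cancelled-from-r₀ l r₀≤r
      ... | inj₂ r≤r₀ = ℚₚ.≤-trans (*-fromℕ-monoˡ-≤ k r≤r₀) (cancelled-from-r₀ l₀ ℚₚ.≤-refl)

  above⇒eventually-≤ : ∀ {r} C → lower a r →
    ∃[ K ] (∀ {k W} → K ℕ.≤ k → Above a C k W → r * fromℕ k ℚ.≤ W)
  above⇒eventually-≤ {r} C l with lower-rounded a l
  ... | r′ , r<r′ , l′ with archimedean (p<q⇒0<q-p r<r′) C
  ...   | K , C<K[r′-r] = K , λ {k} K≤k h → subst (λ q → q * fromℕ k ℚ.≤ _) (cancel r′ r)
    (absorb-constant r′ (r′ - r) k (bound-at h l′)
      (ℚₚ.≤-trans (ℚₚ.<⇒≤ C<K[r′-r]) (K[r′-r]≤[r′-r]k K≤k)))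
    where
    open ℚₚ.≤-Reasoning
    cancel : ∀ r′ r → r′ - (r′ - r) ≡ r
    cancel = solve-∀ ℚ-ring
    instance
      gap-nonNegative : ℚ.NonNegative (r′ - r)
      gap-nonNegative = ℚ.nonNegative (ℚₚ.<⇒≤ (p<q⇒0<q-p r<r′))
    K[r′-r]≤[r′-r]k : ∀ {k} → K ℕ.≤ k → fromℕ K * (r′ - r) ℚ.≤ (r′ - r) * fromℕ k
    K[r′-r]≤[r′-r]k {k} K≤k = begin
      fromℕ K * (r′ - r)  ≡⟨ ℚₚ.*-comm (fromℕ K) (r′ - r) ⟩
      (r′ - r) * fromℕ K  ≤⟨ ℚₚ.*-monoˡ-≤-nonNeg (r′ - r) (fromℕ-mono-≤ K≤k) ⟩
      (r′ - r) * fromℕ k  ∎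

  above⇒multiple-≤ : ∀ C → ∃[ r ] (∀ {k W} → Above a C (suc k) W → r * fromℕ (suc k) ℚ.≤ W)
  above⇒multiple-≤ C with lower-inhabited a
  ... | r , l = r - (C ℚ.⊔ 0ℚ) , λ {k} h →
    absorb-constant r (C ℚ.⊔ 0ℚ) (suc k) (bound-at h l) (C≤[C⊔0]suc k)
    where
    open ℚₚ.≤-Reasoning
    instance
      C⊔0-nonNegative : ℚ.NonNegative (C ℚ.⊔ 0ℚ)
      C⊔0-nonNegative = ℚ.nonNegative (ℚₚ.p≤q⊔p C 0ℚ)
    C≤[C⊔0]suc : ∀ k → C ℚ.≤ (C ℚ.⊔ 0ℚ) * fromℕ (suc k)
    C≤[C⊔0]suc k = begin
      C                             ≤⟨ ℚₚ.p≤p⊔q C 0ℚ ⟩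
      C ℚ.⊔ 0ℚ                      ≡⟨ ℚₚ.*-identityʳ (C ℚ.⊔ 0ℚ) ⟨
      (C ℚ.⊔ 0ℚ) * 1ℚ               ≤⟨ ℚₚ.*-monoˡ-≤-nonNeg (C ℚ.⊔ 0ℚ) (fromℕ-mono-≤ (ℕ.s≤s ℕ.z≤n)) ⟩
      (C ℚ.⊔ 0ℚ) * fromℕ (suc k)    ∎

below⇒eventually-≥ : ∀ b {r} C → upper b r →
  ∃[ K ] (∀ {k W} → K ℕ.≤ k → Below b C k W → W ℚ.≤ r * fromℕ k)
below⇒eventually-≥ b {r} C u =
  let (K , eventually) = above⇒eventually-≤ {neg b} {r = - r} C
        (subst (upper b) (sym (neg-involutive r)) u)
  in K , λ {k} {W} K≤k h → neg-*-cancel-≤ r (fromℕ k) (eventually K≤k h)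

below⇒multiple-≥ : ∀ b C → ∃[ r ] (∀ {k W} → Below b C (suc k) W → W ℚ.≤ r * fromℕ (suc k))
below⇒multiple-≥ b C = let (r , r*k≤-W) = above⇒multiple-≤ {neg b} C in
  - r , λ {k} {W} h → neg-*-cancel-≤ (- r) (fromℕ (suc k))
    (subst (λ q → q * fromℕ (suc k) ℚ.≤ - W) (sym (neg-involutive r)) (r*k≤-W h))

¬above⇒below : ∀ c {k W} → ¬ Above c 0ℚ k W → Below c 0ℚ k W
¬above⇒below c {k} {W} ¬above = above bounded
  where
  bounded : ∀ {r} → upper c (- r) → r * fromℕ k ℚ.≤ - W + 0ℚ
  bounded {r} u with ℚₚ.≤-total W (- r * fromℕ k)
  ... | inj₁ W≤-rk = subst₂ (λ q V → q * fromℕ k ℚ.≤ V) (neg-involutive r) (sym (ℚₚ.+-identityʳ (- W)))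
    (neg-*-antimono-≤ (- r) (fromℕ k) W≤-rk)
  ... | inj₂ -rk≤W = contradiction (above-antitone (≤-fromℚ c u) (above₀-fromℚ -rk≤W)) ¬above

below-+ : ∀ b {C C′ k k′ W W′} → Below b C k W → Below b C′ k′ W′ → Below b (C + C′) (k ℕ.+ k′) (W + W′)
below-+ b {W = W} {W′} h h′ = subst (Above (neg b) _ _) (sym (ℚₚ.neg-distrib-+ W W′)) (above-+ h h′)

module _ {a b : ℝ} where

  within-+ : ∀ {C C′ k k′ W W′} → Within a b C k W → Within a b C′ k′ W′ →
    Within a b (C + C′) (k ℕ.+ k′) (W + W′)
  within-+ {W = W} {W′} (h , g) (h′ , g′) = above-+ h h′ , below-+ b {W = W} {W′} g g′

  within-weaken : ∀ {C C′ k W} → C ℚ.≤ C′ → Within a b C k W → Within a b C′ k W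
  within-weaken C≤C′ (h , g) = above-weaken C≤C′ h , above-weaken C≤C′ g

  within-widen : ∀ {a′ b′ C k W} → a′ ≤ a → b ≤ b′ → Within a b C k W → Within a′ b′ C k W
  within-widen {b′ = b′} a′≤a b≤b′ (h , g) =
    above-antitone a′≤a h , above-antitone (neg-antitone b b′ b≤b′) g

  within-exists : ∀ k W → ∃[ C ] Within a b C k W
  within-exists k W =
    let (C , h) = above-exists {a} k W
        (D , g) = above-exists {neg b} k (- W)
    in C ℚ.⊔ D , above-weaken (ℚₚ.p≤p⊔q C D) h , above-weaken (ℚₚ.p≤q⊔p C D) g

  within-cancel : ∀ k₀ W₀ →
    ∃[ D ] (∀ {C k W} → Within a b C (k₀ ℕ.+ k) (W₀ + W) → Within a b (C + D) k W)
  within-cancel k₀ W₀ =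
    let (D , cancel)   = above-cancel {a} k₀ W₀
        (D′ , cancel′) = above-cancel {neg b} k₀ (- W₀)
    in D ℚ.⊔ D′ , λ {C} {k} {W} (h , g) →
         above-weaken (ℚₚ.+-monoʳ-≤ C (ℚₚ.p≤p⊔q D D′)) (cancel h) ,
         above-weaken (ℚₚ.+-monoʳ-≤ C (ℚₚ.p≤q⊔p D D′))
           (cancel′ (subst (Above (neg b) C (k₀ ℕ.+ k)) (ℚₚ.neg-distrib-+ W₀ W) g))

within-mean : ∀ {q k W} → q * fromℕ k ≡ W → Within (fromℚ q) (fromℚ q) 0ℚ k W
within-mean {q} qk≡W =
  above₀-fromℚ {q} (ℚₚ.≤-reflexive qk≡W) , below₀-fromℚ {q} (ℚₚ.≤-reflexive (sym qk≡W))

-- Limits inferior of averages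

averages : (ℕ → ℤ) → ℕ → ℝ
averages W k = fromℚ (W (suc k) ℚ./ suc k)

≤-average : ∀ {q i} k → q * fromℕ (suc k) ℚ.≤ fromℤ i → q ℚ.≤ i ℚ./ suc k
≤-average {q} {i} k h = ℚₚ.*-cancelʳ-≤-pos (fromℕ (suc k))
  (subst (q * fromℕ (suc k) ℚ.≤_) (sym (/-*-cancel i (suc k))) h)

average-≤ : ∀ {q i} k → fromℤ i ℚ.≤ q * fromℕ (suc k) → i ℚ./ suc k ℚ.≤ q
average-≤ {q} {i} k h = ℚₚ.*-cancelʳ-≤-pos (fromℕ (suc k))
  (subst (ℚ._≤ q * fromℕ (suc k)) (sym (/-*-cancel i (suc k))) h)

module _ (W : ℕ → ℤ) (C : ℚ) (N : ℕ) where

  above⇒≤liminf : ∀ a x → IsLiminf (averages W) x →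
    (∀ k → N ℕ.≤ k → Above a C k (fromℤ (W k))) → a ≤ x
  above⇒≤liminf a x (_ , infima , supremum) aboves q l =
    let (r , q<r , l′) = lower-rounded a l
        (K , eventually) = above⇒eventually-≤ {a} {r = r} C l′
        n = N ℕ.⊔ K
        r≤averages : ∀ j → fromℚ r ≤ averages W (n ℕ.+ j)
        r≤averages j = fromℚ-mono-≤ (≤-average {i = W (suc (n ℕ.+ j))} (n ℕ.+ j)
          (eventually (ℕₚ.m≤n⇒m≤1+n (ℕₚ.m≤n⇒m≤n+o j (ℕₚ.m≤n⊔m N K)))
            (aboves (suc (n ℕ.+ j)) (ℕₚ.m≤n⇒m≤1+n (ℕₚ.m≤n⇒m≤n+o j (ℕₚ.m≤m⊔n N K))))))
    in proj₁ supremum n q (proj₂ (infima n) (fromℚ r) r≤averages q q<r)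

  below⇒liminf≤ : ∀ b x → IsLiminf (averages W) x →
    (∀ k → N ℕ.≤ k → Below b C k (fromℤ (W k))) → x ≤ b
  below⇒liminf≤ b x (inf , infima , supremum) belows = proj₂ supremum b inf≤b
    where
    inf≤fromℚ : ∀ n {r} → upper b r → inf n ≤ fromℚ r
    inf≤fromℚ n {r} u p l =
      let (K , eventually) = below⇒eventually-≥ b {r} C u
          j = N ℕ.⊔ K
          average≤r = average-≤ {i = W (suc (n ℕ.+ j))} (n ℕ.+ j)
            (eventually (ℕₚ.m≤n⇒m≤1+n (ℕₚ.m≤n⇒m≤o+n n (ℕₚ.m≤n⊔m N K)))
              (belows (suc (n ℕ.+ j)) (ℕₚ.m≤n⇒m≤1+n (ℕₚ.m≤n⇒m≤o+n n (ℕₚ.m≤m⊔n N K)))))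
      in ℚₚ.<-≤-trans (proj₁ (infima n) j p l) average≤r

    inf≤b : ∀ n → inf n ≤ b
    inf≤b n q l with lower-rounded (inf n) l
    ... | r , q<r , l′ with located b q<r
    ...   | inj₁ lb = lb
    ...   | inj₂ ub = contradiction (inf≤fromℚ n ub) (lower⇒≱ (inf n) l′)

-- Consequences of excluded middle

module Classical (em : ExcludedMiddle (lsuc 0ℓ)) where

  em₀ : (P : Set) → Dec P
  em₀ P = map′ unlift lift (em {Lift (lsuc 0ℓ) P})

  by-contradiction : {P : Set} → ¬ ¬ P → P
  by-contradiction {P} = decidable-stable (em₀ P)

  ≤-or-> : ∀ x y → x ≤ y ⊎ y < x
  ≤-or-> x y with em₀ (y < x)
  ... | yes y<x = inj₂ y<x
  ... | no  y≮x = inj₁ x≤y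
    where
    x≤y : x ≤ y
    x≤y q l with lower-rounded x l
    ... | r , q<r , l′ with located y q<r
    ...   | inj₁ ly = ly
    ...   | inj₂ uy = contradiction (r , uy , l′) y≮x

  ≤-total : ∀ x y → x ≤ y ⊎ y ≤ x
  ≤-total x y with ≤-or-> x y
  ... | inj₁ x≤y = inj₁ x≤y
  ... | inj₂ y<x = inj₂ (<⇒≤ y x y<x)

  cut : (L : ℚ → Set) → (∀ {p q} → p ℚ.< q → L q → L p) → ∃[ q ] L q → ∃[ q ] ¬ L q → ℝ
  cut L closed (l , Ll) (u , ¬Lu) = record
    { lower           = λ q → ∃[ q′ ] (q ℚ.< q′ × L q′)
    ; upper           = λ q → ∃[ q′ ] (q′ ℚ.< q × ¬ L q′)
    ; lower-inhabited = let (q , q<l) = lower-inhabited (fromℚ l) in q , l , q<l , Ll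
    ; upper-inhabited = let (q , u<q) = upper-inhabited (fromℚ u) in q , u , u<q , ¬Lu
    ; lower-closed    = λ p<q (q′ , q<q′ , Lq′) → q′ , ℚₚ.<-trans p<q q<q′ , Lq′
    ; upper-closed    = λ p<q (p′ , p′<p , ¬Lp′) → p′ , ℚₚ.<-trans p′<p p<q , ¬Lp′
    ; lower-rounded   = λ (q′ , q<q′ , Lq′) →
        let (m , q<m , m<q′) = ℚₚ.<-dense q<q′ in m , q<m , q′ , m<q′ , Lq′
    ; upper-rounded   = λ (q′ , q′<q , ¬Lq′) →
        let (m , q′<m , m<q) = ℚₚ.<-dense q′<q in m , m<q , q′ , q′<m , ¬Lq′
    ; disjoint        = λ ((l′ , q<l′ , Ll′) , (u′ , u′<q , ¬Lu′)) →
        ¬Lu′ (closed (ℚₚ.<-trans u′<q q<l′) Ll′)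
    ; located         = λ p<q → separate (ℚₚ.<-dense p<q)
    }
    where
    separate : ∀ {p q} → ∃[ m ] (p ℚ.< m × m ℚ.< q) →
      ∃[ p′ ] (p ℚ.< p′ × L p′) ⊎ ∃[ q′ ] (q′ ℚ.< q × ¬ L q′)
    separate (m , p<m , m<q) with em₀ (L m)
    ... | yes Lm = inj₁ (m , p<m , Lm)
    ... | no ¬Lm = inj₂ (m , m<q , ¬Lm)

  infimum : (a : ℕ → ℝ) → ∃[ q ] (∀ k → lower (a k) q) → Σ[ x ∈ ℝ ] IsInfimum a x
  infimum a (r , r<a) = x , (λ k q (q′ , q<q′ , l) → lower-closed (a k) q<q′ (l k)) ,
      λ y y≤a q l → let (q′ , q<q′ , l′) = lower-rounded y l in q′ , q<q′ , λ k → y≤a k q′ l′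
    where
    x : ℝ
    x = cut (λ q → ∀ k → lower (a k) q) (λ p<q l k → lower-closed (a k) p<q (l k)) (r , r<a)
      (let (q , u) = upper-inhabited (a 0) in q , λ l → disjoint (a 0) (l 0 , u))

  supremum : (a : ℕ → ℝ) → ∃[ q ] (∀ k → upper (a k) q) → Σ[ x ∈ ℝ ] IsSupremum a x
  supremum a (u , a<u) = x ,
      (λ k q l → let (q′ , q<q′ , l′) = lower-rounded (a k) l in q′ , q<q′ , k , l′) ,
      λ y a≤y q (q′ , q<q′ , k , l) → lower-closed y q<q′ (a≤y k q′ l)
    where
    x : ℝ
    x = cut (λ q → ∃[ k ] lower (a k) q) (λ p<q (k , l) → k , lower-closed (a k) p<q l)
      (let (q , l) = lower-inhabited (a 0) in q , 0 , l)
      (u , λ (k , l) → disjoint (a k) (l , a<u k))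

  bounded⇒liminf : (a : ℕ → ℝ) → ∃[ q ] (∀ k → lower (a k) q) → ∃[ q ] (∀ k → upper (a k) q) →
    Σ[ x ∈ ℝ ] IsLiminf a x
  bounded⇒liminf a (l , lower-bound) (u , upper-bound) =
    let (x , x-supremum) = supremum inf (u , inf-upper-bound)
    in x , inf , proj₂ ∘ infimum-from , x-supremum
    where
    infimum-from : ∀ n → Σ[ y ∈ ℝ ] IsInfimum (λ k → a (n ℕ.+ k)) y
    infimum-from n = infimum (λ k → a (n ℕ.+ k)) (l , λ k → lower-bound (n ℕ.+ k))
    inf : ℕ → ℝ
    inf n = proj₁ (infimum-from n)
    inf-upper-bound : ∀ n → upper (inf n) u
    inf-upper-bound n =
      upper-antitone (inf n) (a (n ℕ.+ 0)) (proj₁ (proj₂ (infimum-from n)) 0) (upper-bound (n ℕ.+ 0))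

  within⇒liminf : ∀ {W : ℕ → ℤ} {a b C} → (∀ k → Within a b C k (fromℤ (W k))) →
    Σ[ x ∈ ℝ ] (IsLiminf (averages W) x × a ≤ x × x ≤ b)
  within⇒liminf {W} {a} {b} {C} within =
    x , liminf , above⇒≤liminf W C 0 a x liminf (λ k _ → is-above (within k)) ,
    below⇒liminf≤ W C 0 b x liminf (λ k _ → is-below (within k))
    where
    lower-bound : ∃[ q ] (∀ k → lower (averages W k) q)
    lower-bound = let (r , r*k≤W) = above⇒multiple-≤ {a} C ; (q , q<r) = lower-inhabited (fromℚ r) in
      q , λ k → ℚₚ.<-≤-trans q<r (≤-average k (r*k≤W (is-above (within (suc k)))))
    upper-bound : ∃[ q ] (∀ k → upper (averages W k) q)
    upper-bound = let (r , W≤r*k) = below⇒multiple-≥ b C ; (q , r<q) = upper-inhabited (fromℚ r) in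
      q , λ k → ℚₚ.≤-<-trans (average-≤ k (W≤r*k (is-below (within (suc k))))) r<q
    liminf-exists : Σ[ x ∈ ℝ ] IsLiminf (averages W) x
    liminf-exists = bounded⇒liminf (averages W) lower-bound upper-bound
    x : ℝ
    x = proj₁ liminf-exists
    liminf : IsLiminf (averages W) x
    liminf = proj₂ liminf-exists

  rational-member : ∀ {I} → NotIrrationalPoint I → ∀ {x} → x ∈ᴵ I → ∃[ c ] fromℚ c ∈ᴵ I
  rational-member {I} not-irrational {x} x∈I with em {Σ[ y ∈ ℝ ] (y ∈ᴵ I × ¬ y ≈ x)}
  ... | no alone =
    let (q , x≤q , q≤x) = not-irrational x x∈I λ y y∈I →
          by-contradiction λ y≉x → alone (y , y∈I , y≉x)
    in q , ∈ᴵ-convex I x∈I x∈I x≤q q≤x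
  ... | yes (y , y∈I , y≉x) with ≤-or-> x y | ≤-or-> y x
  ...   | inj₁ x≤y | inj₁ y≤x = contradiction (y≤x , x≤y) y≉x
  ...   | inj₂ (c , y<c , c<x) | _ = c , ∈ᴵ-convex I y∈I x∈I (≤-fromℚ y y<c) (fromℚ-≤ x c<x)
  ...   | inj₁ _ | inj₂ (c , x<c , c<y) = c , ∈ᴵ-convex I x∈I y∈I (≤-fromℚ x x<c) (fromℚ-≤ y c<y)

-- Walks in weighted graphs

record Weighting {V : Set} (_⟶_ : V → V → Set) : Set where
  field
    weigh        : ∀ {u v} → u ⟶ v → ℚ
    weigh-unique : ∀ {u v} (e e′ : u ⟶ v) → weigh e ≡ weigh e′

open Weighting

Connected : {V : Set} → (V → V → Set) → V → V → Set
Connected _⟶_ u v = Star _⟶_ u v × Star _⟶_ v u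

module _ {V : Set} {_⟶_ : V → V → Set} where

  length : ∀ {u v} → Star _⟶_ u v → ℕ
  length ε       = 0
  length (e ◅ γ) = suc (length γ)

  length-◅◅ : ∀ {u v x} (γ : Star _⟶_ u v) (γ′ : Star _⟶_ v x) →
    length (γ ◅◅ γ′) ≡ length γ ℕ.+ length γ′
  length-◅◅ ε       γ′ = refl
  length-◅◅ (e ◅ γ) γ′ = cong suc (length-◅◅ γ γ′)

  repeat : ∀ {u} → ℕ → Star _⟶_ u u → Star _⟶_ u u
  repeat zero    γ = ε
  repeat (suc m) γ = γ ◅◅ repeat m γ

  sum : Weighting _⟶_ → ∀ {u v} → Star _⟶_ u v → ℚ
  sum w ε       = 0ℚ
  sum w (e ◅ γ) = weigh w e + sum w γ

  negate : Weighting _⟶_ → Weighting _⟶_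
  weigh        (negate w) e    = - weigh w e
  weigh-unique (negate w) e e′ = cong -_ (weigh-unique w e e′)

  shift : ℚ → Weighting _⟶_ → Weighting _⟶_
  weigh        (shift q w) e    = weigh w e - q
  weigh-unique (shift q w) e e′ = cong (_- q) (weigh-unique w e e′)

  sum-negate : ∀ (w : Weighting _⟶_) {u v} (γ : Star _⟶_ u v) → sum (negate w) γ ≡ - sum w γ
  sum-negate w ε       = refl
  sum-negate w (e ◅ γ) =
    trans (cong (- weigh w e +_) (sum-negate w γ)) (sym (ℚₚ.neg-distrib-+ (weigh w e) (sum w γ)))

  sum-shift : ∀ q (w : Weighting _⟶_) {u v} (γ : Star _⟶_ u v) →
    sum (shift q w) γ ≡ sum w γ - q * fromℕ (length γ)
  sum-shift q w ε       = sym (p-q*0≡p 0ℚ q)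
    where
    p-q*0≡p : ∀ p q → p - q * 0ℚ ≡ p
    p-q*0≡p = solve-∀ ℚ-ring
  sum-shift q w (e ◅ γ) = begin
    weigh w e - q + sum (shift q w) γ
      ≡⟨ cong (weigh w e - q +_) (sum-shift q w γ) ⟩
    weigh w e - q + (sum w γ - q * fromℕ (length γ))
      ≡⟨ regroup (weigh w e) q (sum w γ) (fromℕ (length γ)) ⟩
    weigh w e + sum w γ - q * (1ℚ + fromℕ (length γ))
      ≡⟨ cong (λ k → weigh w e + sum w γ - q * k) (fromℕ-+ 1 (length γ)) ⟨
    weigh w e + sum w γ - q * fromℕ (suc (length γ)) ∎
    where
    open ≡-Reasoning
    regroup : ∀ z q W k → z - q + (W - q * k) ≡ z + W - q * (1ℚ + k)
    regroup = solve-∀ ℚ-ring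

  sum-◅◅ : ∀ (w : Weighting _⟶_) {u v x} (γ : Star _⟶_ u v) (γ′ : Star _⟶_ v x) →
    sum w (γ ◅◅ γ′) ≡ sum w γ + sum w γ′
  sum-◅◅ w ε       γ′ = sym (ℚₚ.+-identityˡ (sum w γ′))
  sum-◅◅ w (e ◅ γ) γ′ =
    trans (cong (weigh w e +_) (sum-◅◅ w γ γ′)) (sym (ℚₚ.+-assoc (weigh w e) (sum w γ) (sum w γ′)))

  sum-repeat : ∀ (w : Weighting _⟶_) m {u} (γ : Star _⟶_ u u) → sum w (repeat m γ) ≡ fromℕ m * sum w γ
  sum-repeat w zero    γ = sym (ℚₚ.*-zeroˡ (sum w γ))
  sum-repeat w (suc m) γ = begin
    sum w (γ ◅◅ repeat m γ)        ≡⟨ sum-◅◅ w γ (repeat m γ) ⟩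
    sum w γ + sum w (repeat m γ)   ≡⟨ cong (sum w γ +_) (sum-repeat w m γ) ⟩
    sum w γ + fromℕ m * sum w γ    ≡⟨ collect (sum w γ) (fromℕ m) ⟩
    (1ℚ + fromℕ m) * sum w γ       ≡⟨ cong (_* sum w γ) (fromℕ-+ 1 m) ⟨
    fromℕ (suc m) * sum w γ        ∎
    where
    open ≡-Reasoning
    collect : ∀ W m → W + m * W ≡ (1ℚ + m) * W
    collect = solve-∀ ℚ-ring

  sum-≢0⇒nonempty : ∀ (w : Weighting _⟶_) {u} (γ : Star _⟶_ u u) → sum w γ ≢ 0ℚ → 0 ℕ.< length γ
  sum-≢0⇒nonempty w ε       ≢0 = contradiction refl ≢0
  sum-≢0⇒nonempty w (e ◅ γ) ≢0 = ℕ.s≤s ℕ.z≤n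

  -- Repeating the loop often enough outweighs the way there and back.
  negative-detour : ∀ (w : Weighting _⟶_) {v u} → Connected _⟶_ v u →
    (γ : Star _⟶_ u u) → sum w γ ℚ.< 0ℚ → ∃[ γ′ ] sum w {v} {v} γ′ ℚ.< 0ℚ
  negative-detour w (to , from) γ negative =
    let (m , W<m*-γ) = archimedean (ℚₚ.neg-antimono-< negative) (sum w to + sum w from) in
    to ◅◅ (repeat m γ ◅◅ from) , detour-negative m W<m*-γ
    where
    open ℚₚ.≤-Reasoning
    regroup : ∀ a m z b → a + (m * z + b) ≡ a + b + m * z
    regroup = solve-∀ ℚ-ring
    cancel : ∀ m z → m * - z + m * z ≡ 0ℚ
    cancel = solve-∀ ℚ-ring

    detour-negative : ∀ m → sum w to + sum w from ℚ.< fromℕ m * - sum w γ →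
      sum w (to ◅◅ (repeat m γ ◅◅ from)) ℚ.< 0ℚ
    detour-negative m W<m*-γ = begin-strict
      sum w (to ◅◅ (repeat m γ ◅◅ from))
        ≡⟨ sum-◅◅ w to (repeat m γ ◅◅ from) ⟩
      sum w to + sum w (repeat m γ ◅◅ from)
        ≡⟨ cong (sum w to +_) (sum-◅◅ w (repeat m γ) from) ⟩
      sum w to + (sum w (repeat m γ) + sum w from)
        ≡⟨ cong (λ z → sum w to + (z + sum w from)) (sum-repeat w m γ) ⟩
      sum w to + (fromℕ m * sum w γ + sum w from)
        ≡⟨ regroup (sum w to) (fromℕ m) (sum w γ) (sum w from) ⟩
      sum w to + sum w from + fromℕ m * sum w γ
        <⟨ ℚₚ.+-monoˡ-< (fromℕ m * sum w γ) W<m*-γ ⟩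
      fromℕ m * - sum w γ + fromℕ m * sum w γ
        ≡⟨ cancel (fromℕ m) (sum w γ) ⟩
      0ℚ ∎

  positive-detour : ∀ (w : Weighting _⟶_) {v u} → Connected _⟶_ v u →
    (γ : Star _⟶_ u u) → 0ℚ ℚ.< sum w γ → ∃[ γ′ ] 0ℚ ℚ.< sum w {v} {v} γ′
  positive-detour w v↔u γ positive =
    let (γ′ , negative) = negative-detour (negate w) v↔u γ
          (subst (ℚ._< 0ℚ) (sym (sum-negate w γ)) (ℚₚ.neg-antimono-< positive)) in
    γ′ , subst (0ℚ ℚ.<_) (trans (cong -_ (sum-negate w γ′)) (neg-involutive (sum w γ′)))
      (ℚₚ.neg-antimono-< negative)

  nonempty-◅◅ : ∀ {u v x} {γ : Star _⟶_ u v} {γ′ : Star _⟶_ v x} →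
    0 ℕ.< length γ → 0 ℕ.< length (γ ◅◅ γ′)
  nonempty-◅◅ {γ = e ◅ γ} _ = ℕ.s≤s ℕ.z≤n

  balance : ∀ (w : Weighting _⟶_) {v} (γ γ′ : Star _⟶_ v v) → sum w γ ℚ.< 0ℚ → 0ℚ ℚ.< sum w γ′ →
    ∃[ γ″ ] (0 ℕ.< length {v} {v} γ″ × sum w γ″ ≡ 0ℚ)
  balance w γ γ′ negative positive =
    let (m , m′ , equal) = commensurable (ℚₚ.neg-antimono-< negative) positive in
    repeat (suc m) γ ◅◅ repeat (suc m′) γ′ ,
    nonempty-◅◅ {γ = repeat (suc m) γ} (nonempty-◅◅ {γ = γ} (sum-≢0⇒nonempty w γ (ℚₚ.<⇒≢ negative))) ,
    balanced m m′ equal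
    where
    open ≡-Reasoning
    cancel : ∀ m z → m * z + m * - z ≡ 0ℚ
    cancel = solve-∀ ℚ-ring
    balanced : ∀ m m′ → fromℕ (suc m) * - sum w γ ≡ fromℕ (suc m′) * sum w γ′ →
      sum w (repeat (suc m) γ ◅◅ repeat (suc m′) γ′) ≡ 0ℚ
    balanced m m′ equal = begin
      sum w (repeat (suc m) γ ◅◅ repeat (suc m′) γ′)
        ≡⟨ sum-◅◅ w (repeat (suc m) γ) (repeat (suc m′) γ′) ⟩
      sum w (repeat (suc m) γ) + sum w (repeat (suc m′) γ′)
        ≡⟨ cong₂ _+_ (sum-repeat w (suc m) γ) (sum-repeat w (suc m′) γ′) ⟩
      fromℕ (suc m) * sum w γ + fromℕ (suc m′) * sum w γ′
        ≡⟨ cong (fromℕ (suc m) * sum w γ +_) equal ⟨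
      fromℕ (suc m) * sum w γ + fromℕ (suc m) * - sum w γ
        ≡⟨ cancel (fromℕ (suc m)) (sum w γ) ⟩
      0ℚ ∎

  vertex-at : ∀ {u v} (γ : Star _⟶_ u v) → Fin (suc (length γ)) → V
  vertex-at {u} γ       Fin.zero    = u
  vertex-at     (e ◅ γ) (Fin.suc i) = vertex-at γ i

  record Splitting {u v} (γ : Star _⟶_ u v) (x : V) (k : ℕ) : Set where
    field
      before   : Star _⟶_ u x
      after    : Star _⟶_ x v
      joins    : γ ≡ before ◅◅ after
      length≡k : length before ≡ k

  split-at : ∀ {u v} (γ : Star _⟶_ u v) i → Splitting γ (vertex-at γ i) (toℕ i)
  split-at γ       Fin.zero    = record { before = ε ; after = γ ; joins = refl ; length≡k = refl }
  split-at (e ◅ γ) (Fin.suc i) = record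
    { before = e ◅ before ; after = after ; joins = cong (e ◅_) joins ; length≡k = cong suc length≡k }
    where open Splitting (split-at γ i)

  record LoopIn {u v} (γ : Star _⟶_ u v) (m : ℕ) : Set where
    field
      {base}   : V
      before   : Star _⟶_ u base
      loop     : Star _⟶_ base base
      after    : Star _⟶_ base v
      joins    : γ ≡ before ◅◅ (loop ◅◅ after)
      nonempty : 0 ℕ.< length loop
      short    : length loop ℕ.≤ m

  repetition⇒loop : ∀ {u v} (γ : Star _⟶_ u v) {i j} → i Fin.< j → vertex-at γ i ≡ vertex-at γ j →
    LoopIn γ (toℕ j)
  repetition⇒loop γ {Fin.zero} {Fin.suc j} _ same = record
    { before = ε ; loop = before ; after = after ; joins = joins
    ; nonempty = subst (0 ℕ.<_) (sym length≡k) (ℕ.s≤s ℕ.z≤n) ; short = ℕₚ.≤-reflexive length≡k }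
    where open Splitting (subst (λ x → Splitting γ x (suc (toℕ j))) (sym same) (split-at γ (Fin.suc j)))
  repetition⇒loop (e ◅ γ) {Fin.suc i} {Fin.suc j} (ℕ.s≤s i<j) same = record
    { before = e ◅ before ; loop = loop ; after = after ; joins = cong (e ◅_) joins
    ; nonempty = nonempty ; short = ℕₚ.m≤n⇒m≤1+n short }
    where open LoopIn (repetition⇒loop γ i<j same)

long⇒loop : ∀ {n} {_⟶_ : Fin n → Fin n → Set} {u v} (γ : Star _⟶_ u v) → n ℕ.< length γ → LoopIn γ n
long⇒loop {n} γ n<k
  with Finₚ.pigeonhole (ℕₚ.n<1+n n) (λ i → vertex-at γ (inject≤ i (ℕ.s≤s (ℕₚ.<⇒≤ n<k))))
... | i , j , i<j , same = record { LoopIn found ; short = ℕₚ.≤-trans (LoopIn.short found) j≤n }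
  where
  found : LoopIn γ (toℕ (inject≤ j (ℕ.s≤s (ℕₚ.<⇒≤ n<k))))
  found = repetition⇒loop γ
    (subst₂ ℕ._<_ (sym (Finₚ.toℕ-inject≤ i _)) (sym (Finₚ.toℕ-inject≤ j _)) i<j) same
  j≤n : toℕ (inject≤ j (ℕ.s≤s (ℕₚ.<⇒≤ n<k))) ℕ.≤ n
  j≤n = subst (ℕ._≤ n) (sym (Finₚ.toℕ-inject≤ j _)) (Finₚ.toℕ≤pred[n] j)

short-loops⇒closed-≥0 : ∀ {n} {_⟶_ : Fin n → Fin n → Set} (w : Weighting _⟶_) {v} →
  (∀ {u} → Connected _⟶_ v u → (γ : Star _⟶_ u u) → length γ ℕ.≤ n → 0ℚ ℚ.≤ sum w γ) →
  ∀ {u} → Connected _⟶_ v u → (γ : Star _⟶_ u u) → 0ℚ ℚ.≤ sum w γ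
short-loops⇒closed-≥0 {n} {_⟶_} w short-≥0 {u} v↔u γ = by-length γ (<-wellFounded (length γ))
  where
  by-length : (γ : Star _⟶_ u u) → Acc ℕ._<_ (length γ) → 0ℚ ℚ.≤ sum w γ
  by-length γ (acc shorter) with length γ ℕₚ.≤? n
  ... | yes short = short-≥0 v↔u γ short
  ... | no  long  = subst (0ℚ ℚ.≤_) (sym excised-weight)
      (ℚₚ.+-mono-≤ (short-≥0 (proj₁ v↔u ◅◅ before , after ◅◅ proj₂ v↔u) loop short)
        (by-length (before ◅◅ after) (shorter excised-shorter)))
    where
    open LoopIn (long⇒loop γ (ℕₚ.≰⇒> long))
    swap-front : ∀ a b c → a + (b + c) ≡ b + (a + c)
    swap-front = solve-∀ ℚ-ring
    excised-weight : sum w γ ≡ sum w loop + sum w (before ◅◅ after)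
    excised-weight = begin
      sum w γ
        ≡⟨ cong (sum w) joins ⟩
      sum w (before ◅◅ (loop ◅◅ after))
        ≡⟨ sum-◅◅ w before (loop ◅◅ after) ⟩
      sum w before + sum w (loop ◅◅ after)
        ≡⟨ cong (sum w before +_) (sum-◅◅ w loop after) ⟩
      sum w before + (sum w loop + sum w after)
        ≡⟨ swap-front (sum w before) (sum w loop) (sum w after) ⟩
      sum w loop + (sum w before + sum w after)
        ≡⟨ cong (sum w loop +_) (sum-◅◅ w before after) ⟨
      sum w loop + sum w (before ◅◅ after) ∎
      where open ≡-Reasoning
    excised-shorter : length (before ◅◅ after) ℕ.< length γ
    excised-shorter = begin-strict
      length (before ◅◅ after)
        ≡⟨ length-◅◅ before after ⟩
      length before ℕ.+ length after
        <⟨ ℕₚ.+-monoʳ-< (length before) (ℕₚ.m<n+m (length after) nonempty) ⟩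
      length before ℕ.+ (length loop ℕ.+ length after)
        ≡⟨ cong (length before ℕ.+_) (length-◅◅ loop after) ⟨
      length before ℕ.+ length (loop ◅◅ after)
        ≡⟨ length-◅◅ before (loop ◅◅ after) ⟨
      length (before ◅◅ (loop ◅◅ after))
        ≡⟨ cong length joins ⟨
      length γ ∎
      where open ℕₚ.≤-Reasoning

-- Uniform choices over finite sets

Directed : {D : Set} → (D → D → Set) → Set
Directed _≲_ = ∀ c d → ∃[ e ] (c ≲ e × d ≲ e)

uniform : ∀ {D} {_≲_ : D → D → Set} → Directed _≲_ → D → ∀ {n} {P : Fin n → D → Set} →
  (∀ i → P i Respects _≲_) → (∀ i → ∃[ d ] P i d) → ∃[ d ] (∀ i → P i d)
uniform directed d₀ {zero}  respects choice = d₀ , λ ()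
uniform directed d₀ {suc n} respects choice
  with choice Fin.zero | uniform directed d₀ (respects ∘ Fin.suc) (choice ∘ Fin.suc)
... | c , pc | d , pd with directed c d
...   | e , c≲e , d≲e = e , λ where
  Fin.zero    → respects Fin.zero c≲e pc
  (Fin.suc i) → respects (Fin.suc i) d≲e (pd i)

ℚ-directed : Directed ℚ._≤_
ℚ-directed p q = p ℚ.⊔ q , ℚₚ.p≤p⊔q p q , ℚₚ.p≤q⊔p p q

ℕ-directed : Directed ℕ._≤_
ℕ-directed m n = m ℕ.⊔ n , ℕₚ.m≤m⊔n m n , ℕₚ.m≤n⊔m m n

UpperRational : ℝ → Set
UpperRational x = ∃[ q ] upper x q

upper-rationals-directed : ∀ x → Directed {UpperRational x} (λ (p , _) (q , _) → q ℚ.≤ p)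
upper-rationals-directed x (p , up) (q , uq) with ℚₚ.≤-total p q
... | inj₁ p≤q = (p , up) , ℚₚ.≤-refl , p≤q
... | inj₂ q≤p = (q , uq) , q≤p , ℚₚ.≤-refl

Recurrent : {A : Set} → (ℕ → A) → ℕ → Set
Recurrent ρ N = ∀ i → ∃[ j ] (i ℕ.≤ j × ρ j ≡ ρ N)

recurrent-exists : ExcludedMiddle (lsuc 0ℓ) → ∀ {n} (ρ : ℕ → Fin n) → ∃[ N ] Recurrent ρ N
recurrent-exists em {n} ρ = by-contradiction λ none →
  let (N , all-abandoned) = uniform ℕ-directed 0
        (λ u i≤j left k → left k ∘ ℕₚ.≤-trans i≤j) (abandoned none)
  in all-abandoned (ρ N) N ℕₚ.≤-refl refl
  where
  open Classical em

  Abandoned : Fin n → ℕ → Set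
  Abandoned u i = ∀ j → i ℕ.≤ j → ρ j ≢ u

  revisited : ∀ {u} → ¬ (∃[ i ] Abandoned u i) → ∀ i → ∃[ j ] (i ℕ.≤ j × ρ j ≡ u)
  revisited never i = by-contradiction λ ∄visit → never (i , λ j i≤j ρj≡u → ∄visit (j , i≤j , ρj≡u))

  abandoned : ¬ (∃[ N ] Recurrent ρ N) → ∀ u → ∃[ i ] Abandoned u i
  abandoned none u = by-contradiction λ never →
    let (N , _ , ρN≡u) = revisited never 0 in
    none (N , λ i → let (j , i≤j , ρj≡u) = revisited never i in j , i≤j , trans ρj≡u (sym ρN≡u))

-- Infinite paths

record Path {V : Set} (_⟶_ : V → V → Set) : Set where
  field
    vertex : ℕ → V
    step   : ∀ k → vertex k ⟶ vertex (suc k)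

module _ {V : Set} {_⟶_ : V → V → Set} where
  open Path

  subwalk : ∀ (π : Path _⟶_) {i j} → i ℕ.≤′ j → Star _⟶_ (vertex π i) (vertex π j)
  subwalk π ℕ.≤′-refl           = ε
  subwalk π (ℕ.≤′-step {j} i≤j) = subwalk π i≤j ◅◅ (step π j ◅ ε)

  sum-subwalk-step : ∀ (w : Weighting _⟶_) π {i j} (i≤j : i ℕ.≤′ j) →
    sum w (subwalk π (ℕ.≤′-step i≤j)) ≡ sum w (subwalk π i≤j) + weigh w (step π j)
  sum-subwalk-step w π {j = j} i≤j = trans (sum-◅◅ w (subwalk π i≤j) (step π j ◅ ε))
    (cong (sum w (subwalk π i≤j) +_) (ℚₚ.+-identityʳ (weigh w (step π j))))

  initial-walk : ∀ (π : Path _⟶_) k → Star _⟶_ (vertex π 0) (vertex π k)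
  initial-walk π k = subwalk π (ℕₚ.z≤′n {k})

  partial-sum : Weighting _⟶_ → Path _⟶_ → ℕ → ℚ
  partial-sum w π k = sum w (initial-walk π k)

  partial-sum-suc : ∀ (w : Weighting _⟶_) π k →
    partial-sum w π (suc k) ≡ partial-sum w π k + weigh w (step π k)
  partial-sum-suc w π k = sum-subwalk-step w π (ℕₚ.z≤′n {k})

  partial-sum-subwalk : ∀ (w : Weighting _⟶_) π {i j} (i≤j : i ℕ.≤′ j) →
    partial-sum w π j ≡ partial-sum w π i + sum w (subwalk π i≤j)
  partial-sum-subwalk w π ℕ.≤′-refl = sym (ℚₚ.+-identityʳ _)
  partial-sum-subwalk w π {i} (ℕ.≤′-step {j} i≤j) = begin
    S (suc j)                                     ≡⟨ partial-sum-suc w π j ⟩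
    S j + z                                       ≡⟨ cong (_+ z) (partial-sum-subwalk w π i≤j) ⟩
    S i + sum w (subwalk π i≤j) + z               ≡⟨ ℚₚ.+-assoc (S i) (sum w (subwalk π i≤j)) z ⟩
    S i + (sum w (subwalk π i≤j) + z)             ≡⟨ cong (S i +_) (sum-subwalk-step w π i≤j) ⟨
    S i + sum w (subwalk π (ℕ.≤′-step i≤j))       ∎
    where
    open ≡-Reasoning
    S : ℕ → ℚ
    S = partial-sum w π
    z : ℚ
    z = weigh w (step π j)

  length-initial-walk : ∀ π k → length (initial-walk π k) ≡ k
  length-initial-walk π zero    = refl
  length-initial-walk π (suc k) = begin
    length (initial-walk π k ◅◅ (step π k ◅ ε))   ≡⟨ length-◅◅ (initial-walk π k) (step π k ◅ ε) ⟩
    length (initial-walk π k) ℕ.+ 1               ≡⟨ ℕₚ.+-comm (length (initial-walk π k)) 1 ⟩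
    suc (length (initial-walk π k))               ≡⟨ cong suc (length-initial-walk π k) ⟩
    suc k                                         ∎
    where open ≡-Reasoning

  partial-sum-shift : ∀ q (w : Weighting _⟶_) π k →
    partial-sum (shift q w) π k ≡ partial-sum w π k - q * fromℕ k
  partial-sum-shift q w π k = trans (sum-shift q w (initial-walk π k))
    (cong (λ m → partial-sum w π k - q * fromℕ m) (length-initial-walk π k))

-- Cycle means

record Cycle {V : Set} {_⟶_ : V → V → Set} (w : Weighting _⟶_) (v : V) (μ : ℚ) : Set where
  field
    {base}    : V
    connected : Connected _⟶_ v base
    loop      : Star _⟶_ base base
    nonempty  : 0 ℕ.< length loop
    mean      : μ * fromℕ (length loop) ≡ sum w loop

module _ {V : Set} {_⟶_ : V → V → Set} where
  open Cycle

  light⇒below : ∀ (w : Weighting _⟶_) x {q u v} (γ : Star _⟶_ u v) → lower x q →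
    sum (shift q w) γ ℚ.≤ 0ℚ → Below x 0ℚ (length γ) (sum w γ)
  light⇒below w x {q} γ q<x light = above-antitone (neg-antitone (fromℚ q) x (fromℚ-≤ x q<x))
    (below₀-fromℚ {q} (p-q≤0⇒p≤q (subst (ℚ._≤ 0ℚ) (sum-shift q w γ) light)))

  heavy⇒above : ∀ (w : Weighting _⟶_) x {q u v} (γ : Star _⟶_ u v) → upper x q →
    0ℚ ℚ.≤ sum (shift q w) γ → Above x 0ℚ (length γ) (sum w γ)
  heavy⇒above w x {q} γ x<q heavy = above-antitone (≤-fromℚ x x<q)
    (above₀-fromℚ {q} (0≤q-p⇒p≤q (subst (0ℚ ℚ.≤_) (sum-shift q w γ) heavy)))

  mean-exists : ∀ (w : Weighting _⟶_) {u v} (γ : Star _⟶_ u v) → 0 ℕ.< length γ →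
    ∃[ μ ] μ * fromℕ (length γ) ≡ sum w γ
  mean-exists w γ@(_ ◅ _) _ = sum w γ ÷ fromℕ (length γ) , ÷-*-cancel (sum w γ) (fromℕ (length γ))

  negate-cycle : ∀ {w : Weighting _⟶_} {v μ} → Cycle (negate w) v μ → Cycle w v (- μ)
  negate-cycle {w} {μ = μ} c = record { Cycle c ; mean = begin
    - μ * fromℕ (length (loop c))     ≡⟨ ℚₚ.neg-distribˡ-* μ (fromℕ (length (loop c))) ⟨
    - (μ * fromℕ (length (loop c)))   ≡⟨ cong -_ (mean c) ⟩
    - sum (negate w) (loop c)         ≡⟨ cong -_ (sum-negate w (loop c)) ⟩
    - (- sum w (loop c))              ≡⟨ neg-involutive (sum w (loop c)) ⟩
    sum w (loop c)                    ∎ }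
    where open ≡-Reasoning

  module _ {w : Weighting _⟶_} {v μ} (c : Cycle w v μ) where

    private
      k : ℚ
      k = fromℕ (length (loop c))
      instance
        k-positive : ℚ.Positive k
        k-positive = ℚ.positive (fromℕ-mono-< (nonempty c))

    sum-shift-cycle : ∀ q → sum (shift q w) (loop c) ≡ μ * k - q * k
    sum-shift-cycle q = trans (sum-shift q w (loop c)) (cong (_- q * k) (sym (mean c)))

    cycle⇒light-walk : ∀ {q} → μ ℚ.< q → ∃[ γ ] sum (shift q w) {v} {v} γ ℚ.< 0ℚ
    cycle⇒light-walk {q} μ<q = negative-detour (shift q w) (connected c) (loop c) (begin-strict
      sum (shift q w) (loop c)          ≡⟨ sum-shift-cycle q ⟩
      μ * k - q * k                     <⟨ ℚₚ.+-monoˡ-< (- (q * k)) (ℚₚ.*-monoˡ-<-pos k μ<q) ⟩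
      q * k - q * k                     ≡⟨ ℚₚ.+-inverseʳ (q * k) ⟩
      0ℚ                                ∎)
      where open ℚₚ.≤-Reasoning

    cycle⇒heavy-walk : ∀ {q} → q ℚ.< μ → ∃[ γ ] 0ℚ ℚ.< sum (shift q w) {v} {v} γ
    cycle⇒heavy-walk {q} q<μ = positive-detour (shift q w) (connected c) (loop c) (begin-strict
      0ℚ                                ≡⟨ ℚₚ.+-inverseʳ (q * k) ⟨
      q * k - q * k                     <⟨ ℚₚ.+-monoˡ-< (- (q * k)) (ℚₚ.*-monoˡ-<-pos k q<μ) ⟩
      μ * k - q * k                     ≡⟨ sum-shift-cycle q ⟨
      sum (shift q w) (loop c)          ∎)
      where open ℚₚ.≤-Reasoning

-- Paths in finite graphs

module FiniteGraph (em : ExcludedMiddle (lsuc 0ℓ)) {n : ℕ} {_⟶_ : Fin n → Fin n → Set} where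
  open Classical em
  open Path

  module _ {D : Set} {_≲_ : D → D → Set} (directed : Directed _≲_) (d₀ : D) (w : Weighting _⟶_) where

    uniform-over-walks-from : ∀ m u {P : Fin n → ℕ → ℚ → D → Set} → (∀ {v k W} → P v k W Respects _≲_) →
      (∀ v (γ : Star _⟶_ u v) → length γ ℕ.≤ m → ∃[ d ] P v (length γ) (sum w γ) d) →
      ∃[ d ] (∀ v (γ : Star _⟶_ u v) → length γ ℕ.≤ m → P v (length γ) (sum w γ) d)
    uniform-over-walks-from zero u respects choice with choice u ε ℕ.z≤n
    ... | d , pd = d , λ { _ ε _ → pd }
    uniform-over-walks-from (suc m) u {P} respects choice
      with choice u ε ℕ.z≤n | uniform directed d₀ respects-after after
      where
      After : Fin n → D → Set
      After x d = (e : u ⟶ x) → ∀ v (γ : Star _⟶_ x v) → length γ ℕ.≤ m →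
        P v (suc (length γ)) (weigh w e + sum w γ) d

      respects-after : ∀ x → After x Respects _≲_
      respects-after x c≲d h e v γ short = respects c≲d (h e v γ short)

      after : ∀ x → ∃[ d ] After x d
      after x with em₀ (u ⟶ x)
      ... | no  ∄e = d₀ , λ e → contradiction e ∄e
      ... | yes e  with uniform-over-walks-from m x {λ v k W → P v (suc k) (weigh w e + W)} respects
                          (λ v γ short → choice v (e ◅ γ) (ℕ.s≤s short))
      ...   | d , pd = d , λ e′ v γ short →
        subst (λ z → P v (suc (length γ)) (z + sum w γ) d) (weigh-unique w e e′) (pd v γ short)
    ... | c , pc | d , pd with directed c d
    ...   | b , c≲b , d≲b = b , λ where
      _ ε       _             → respects c≲b pc
      _ (e ◅ γ) (ℕ.s≤s short) → respects d≲b (pd _ e _ γ short)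

    uniform-over-walks : ∀ m {P : Fin n → Fin n → ℕ → ℚ → D → Set} →
      (∀ {u v k W} → P u v k W Respects _≲_) →
      (∀ u v (γ : Star _⟶_ u v) → length γ ℕ.≤ m → ∃[ d ] P u v (length γ) (sum w γ) d) →
      ∃[ d ] (∀ u v (γ : Star _⟶_ u v) → length γ ℕ.≤ m → P u v (length γ) (sum w γ) d)
    uniform-over-walks m {P} respects choice = uniform directed d₀
      (λ u c≲d h v γ short → respects c≲d (h v γ short))
      (λ u → uniform-over-walks-from m u {P u} respects (choice u))

  closed-≥0⇒walks-bounded : ∀ (w : Weighting _⟶_) {v} → (∀ (γ : Star _⟶_ v v) → 0ℚ ℚ.≤ sum w γ) →
    ∃[ C ] (∀ u → Star _⟶_ u v → (γ : Star _⟶_ v u) → 0ℚ ℚ.≤ sum w γ + C)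
  closed-≥0⇒walks-bounded w {v} closed-≥0 = uniform ℚ-directed 0ℚ
    (λ u C≤D bound back γ → ℚₚ.≤-trans (bound back γ) (ℚₚ.+-monoʳ-≤ (sum w γ) C≤D)) bound-at-vertex
    where
    bound-at-vertex : ∀ u → ∃[ C ] (Star _⟶_ u v → (γ : Star _⟶_ v u) → 0ℚ ℚ.≤ sum w γ + C)
    bound-at-vertex u with em₀ (Star _⟶_ u v)
    ... | no  ∄back = 0ℚ , λ back → contradiction back ∄back
    ... | yes back  = sum w back , λ _ γ → subst (0ℚ ℚ.≤_) (sum-◅◅ w γ back) (closed-≥0 (γ ◅◅ back))

  closed-≥0⇒tail-bounded : ∀ (w : Weighting _⟶_) (π : Path _⟶_) N →
    (∀ (γ : Star _⟶_ (vertex π N) (vertex π N)) → 0ℚ ℚ.≤ sum w γ) →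
    (∀ {i} → N ℕ.≤ i → Star _⟶_ (vertex π i) (vertex π N)) →
    ∃[ C ] (∀ k → N ℕ.≤ k → 0ℚ ℚ.≤ partial-sum w π k + C)
  closed-≥0⇒tail-bounded w π N closed-≥0 back with closed-≥0⇒walks-bounded w closed-≥0
  ... | C , bounded = C - partial-sum w π N , λ k N≤k →
    let γ = subwalk π (ℕₚ.≤⇒≤′ N≤k) in
    subst (0ℚ ℚ.≤_) (sym (tail-sum (ℕₚ.≤⇒≤′ N≤k))) (bounded (vertex π k) (back N≤k) γ)
    where
    open ≡-Reasoning
    cancel : ∀ a b c → a + b + (c - a) ≡ b + c
    cancel = solve-∀ ℚ-ring
    tail-sum : ∀ {k} (N≤k : N ℕ.≤′ k) →
      partial-sum w π k + (C - partial-sum w π N) ≡ sum w (subwalk π N≤k) + C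
    tail-sum {k} N≤k = begin
      partial-sum w π k + (C - partial-sum w π N)
        ≡⟨ cong (_+ (C - partial-sum w π N)) (partial-sum-subwalk w π N≤k) ⟩
      partial-sum w π N + sum w (subwalk π N≤k) + (C - partial-sum w π N)
        ≡⟨ cancel (partial-sum w π N) (sum w (subwalk π N≤k)) C ⟩
      sum w (subwalk π N≤k) + C ∎

  GrowsAtLeast : ℚ → Weighting _⟶_ → Path _⟶_ → Set
  GrowsAtLeast q w π = ∃[ C ] ∃[ N ] (∀ k → N ℕ.≤ k → q * fromℕ k ℚ.≤ partial-sum w π k + C)

  module _ (w : Weighting _⟶_) (π : Path _⟶_) {N : ℕ} (recurrent : Recurrent (vertex π) N) where

    private
      v : Fin n
      v = vertex π N

    walk-back : ∀ {i} → N ℕ.≤ i → Star _⟶_ (vertex π i) v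
    walk-back {i} N≤i = let (j , i≤j , same) = recurrent i in
      subst (Star _⟶_ (vertex π i)) same (subwalk π (ℕₚ.≤⇒≤′ i≤j))

    short-loops⇒grows : ∀ q → (∀ {u} → Connected _⟶_ v u → (γ : Star _⟶_ u u) → 0 ℕ.< length γ →
      length γ ℕ.≤ n → q * fromℕ (length γ) ℚ.≤ sum w γ) → GrowsAtLeast q w π
    short-loops⇒grows q heavy =
      let (C , bounded) = closed-≥0⇒tail-bounded (shift q w) π N
            (short-loops⇒closed-≥0 (shift q w) short-≥0 (ε , ε)) walk-back in
      C , N , λ k N≤k → unshift k C (bounded k N≤k)
      where
      short-≥0 : ∀ {u} → Connected _⟶_ v u → (γ : Star _⟶_ u u) → length γ ℕ.≤ n →
        0ℚ ℚ.≤ sum (shift q w) γ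
      short-≥0 _ ε _ = ℚₚ.≤-refl
      short-≥0 v↔u γ@(_ ◅ _) short =
        subst (0ℚ ℚ.≤_) (sym (sum-shift q w γ)) (p≤q⇒0≤q-p (heavy v↔u γ (ℕ.s≤s ℕ.z≤n) short))

      regroup : ∀ S y C → S - y + C ≡ S + C - y
      regroup = solve-∀ ℚ-ring

      unshift : ∀ k C → 0ℚ ℚ.≤ partial-sum (shift q w) π k + C → q * fromℕ k ℚ.≤ partial-sum w π k + C
      unshift k C = 0≤q-p⇒p≤q ∘ subst (0ℚ ℚ.≤_)
        (trans (cong (_+ C) (partial-sum-shift q w π k)) (regroup (partial-sum w π k) (q * fromℕ k) C))

    light-cycle : ∀ x → (∀ {q} → upper x q → ¬ GrowsAtLeast q w π) →
      ∃[ μ ] (fromℚ μ ≤ x × Cycle w v μ)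
    light-cycle x slow = by-contradiction λ none →
      let ((q , x<q) , all-heavy) = uniform-over-walks
            (upper-rationals-directed x) (upper-inhabited x) w n {Heavy}
            (λ {_} {_} {k} r≤q qk≤W loop → ℚₚ.≤-trans (*-fromℕ-monoˡ-≤ k r≤q) (qk≤W loop)) (heavy none)
      in slow x<q (short-loops⇒grows q λ v↔u γ nonempty short →
           all-heavy _ _ γ short (refl , v↔u , nonempty))
      where
      Heavy : Fin n → Fin n → ℕ → ℚ → UpperRational x → Set
      Heavy u u′ k W (q , _) = u ≡ u′ × Connected _⟶_ v u × 0 ℕ.< k → q * fromℕ k ℚ.≤ W

      heavy : ¬ (∃[ μ ] (fromℚ μ ≤ x × Cycle w v μ)) →
        ∀ u u′ (γ : Star _⟶_ u u′) → length γ ℕ.≤ n → ∃[ q ] Heavy u u′ (length γ) (sum w γ) q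
      heavy none u u′ γ _ with em₀ (u ≡ u′ × Connected _⟶_ v u × 0 ℕ.< length γ)
      ... | no  not-loop = upper-inhabited x , λ loop → contradiction loop not-loop
      ... | yes (refl , v↔u , nonempty) with mean-exists w γ nonempty
      ...   | μ , mean with ≤-or-> (fromℚ μ) x
      ...     | inj₁ μ≤x = contradiction
        (μ , μ≤x , record { connected = v↔u ; loop = γ ; nonempty = nonempty ; mean = mean }) none
      ...     | inj₂ (q , x<q , q<μ) = (q , x<q) , λ _ →
        ℚₚ.≤-trans (*-fromℕ-monoˡ-≤ (length γ) (ℚₚ.<⇒≤ q<μ)) (ℚₚ.≤-reflexive mean)

  heavy-cycle : ∀ (w : Weighting _⟶_) (π : Path _⟶_) {N} → Recurrent (vertex π) N →
    ∀ x → (∀ {q} → lower x (- q) → ¬ GrowsAtLeast q (negate w) π) →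
    ∃[ ν ] (x ≤ fromℚ ν × Cycle w (vertex π N) ν)
  heavy-cycle w π recurrent x slow =
    let (μ , μ≤-x , cycle) = light-cycle (negate w) π recurrent (neg x) slow in
    - μ , x≤-μ μ≤-x , negate-cycle cycle
    where
    x≤-μ : ∀ {μ} → fromℚ μ ≤ neg x → x ≤ fromℚ (- μ)
    x≤-μ {μ} μ≤-x q q<x =
      p<-q⇒q<-p (upper-antitone (fromℚ μ) (neg x) μ≤-x (subst (lower x) (sym (neg-involutive q)) q<x))

-- Paths made of loops

EventuallyPeriodic : {A : Set} → (ℕ → A) → Set
EventuallyPeriodic f = ∃[ k ] ∃[ d ] (∀ j → f (j ℕ.+ (d ℕ.+ suc k)) ≡ f (j ℕ.+ k))

module _ {V : Set} (_⟶_ : V → V → Set) (v : V) where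

  Loop : Set
  Loop = Σ[ γ ∈ Star _⟶_ v v ] 0 ℕ.< length γ

  Cursor : Set
  Cursor = ∃[ u ] Star _⟶_ u v

-- At a return to v after k steps of weight W, the tour goes on with the loop choose k W.  A cursor
-- consists of the current vertex and the walk that remains until the next return.
module Tour {V : Set} {_⟶_ : V → V → Set} {v : V} (w : Weighting _⟶_)
  (choose : ℕ → ℚ → Loop _⟶_ v) (start : Cursor _⟶_ v) where

  advance : Loop _⟶_ v → ((u , _) : Cursor _⟶_ v) → Σ[ (u′ , _) ∈ Cursor _⟶_ v ] u ⟶ u′
  advance _           (_ , e ◅ γ) = (_ , γ) , e
  advance (e ◅ γ , _) (_ , ε)     = (_ , γ) , e

  progress : ℕ → Cursor _⟶_ v × ℚ
  progress zero    = start , 0ℚ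
  progress (suc t) =
    let (c , W) = progress t ; (c′ , e) = advance (choose t W) c in c′ , W + weigh w e

  cursor : ℕ → Cursor _⟶_ v
  cursor t = proj₁ (progress t)

  travelled : ℕ → ℚ
  travelled t = proj₂ (progress t)

  rest : ∀ t → Star _⟶_ (proj₁ (cursor t)) v
  rest t = proj₂ (cursor t)

  tour : Path _⟶_
  tour = record
    { vertex = λ t → proj₁ (cursor t)
    ; step   = λ t → proj₂ (advance (choose t (travelled t)) (cursor t)) }

  partial-sum-tour : ∀ t → partial-sum w tour t ≡ travelled t
  partial-sum-tour zero    = refl
  partial-sum-tour (suc t) =
    trans (partial-sum-suc w tour t) (cong (_+ weigh w (Path.step tour t)) (partial-sum-tour t))

  module _ {Inv : ℕ → ℚ → Set} {m : ℕ} where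

    HoldsAfter : ℕ → ℚ → ∀ {u} → Star _⟶_ u v → Set
    HoldsAfter k W γ = Inv (k ℕ.+ length γ) (W + sum w γ) × length γ ℕ.≤ m

    after-edge : ∀ k W {u u′} (e : u ⟶ u′) (γ : Star _⟶_ u′ v) →
      HoldsAfter k W (e ◅ γ) → HoldsAfter (suc k) (W + weigh w e) γ
    after-edge k W e γ (inv , short) =
      subst₂ Inv (ℕₚ.+-suc k (length γ)) (sym (ℚₚ.+-assoc W (weigh w e) (sum w γ))) inv , ℕₚ.<⇒≤ short

    after-advance : ∀ k W (L : Loop _⟶_ v) c → HoldsAfter k W (proj₂ c) →
      (Inv k W → HoldsAfter k W (proj₁ L)) →
      let (c′ , e) = advance L c in HoldsAfter (suc k) (W + weigh w e) (proj₂ c′)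
    after-advance k W _           (_ , e ◅ γ) holds     _    = after-edge k W e γ holds
    after-advance k W (e ◅ γ , _) (_ , ε)     (inv , _) next =
      after-edge k W e γ (next (subst₂ Inv (ℕₚ.+-identityʳ k) (ℚₚ.+-identityʳ W) inv))

    tour-invariant : HoldsAfter 0 0ℚ (proj₂ start) →
      (∀ k W → Inv k W → HoldsAfter k W (proj₁ (choose k W))) →
      ∀ t → HoldsAfter t (travelled t) (rest t)
    tour-invariant after-start after-choice zero    = after-start
    tour-invariant after-start after-choice (suc t) =
      after-advance t (travelled t) (choose t (travelled t)) (cursor t)
        (tour-invariant after-start after-choice t) (after-choice t (travelled t))

module _ {V : Set} {_⟶_ : V → V → Set} {v : V} (w : Weighting _⟶_)
  (L : Loop _⟶_ v) (start : Cursor _⟶_ v) where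
  open Tour w (λ _ _ → L) start

  returns : ∀ k t → length (rest t) ≡ k → cursor (k ℕ.+ t) ≡ (v , ε)
  returns zero    t at-end with cursor t
  returns zero    t refl | _ , ε = refl
  returns (suc k) t k-left = subst (λ s → cursor s ≡ (v , ε)) (ℕₚ.+-suc k t)
    (returns k (suc t) (one-less (cursor t) k-left))
    where
    one-less : ∀ c → length (proj₂ c) ≡ suc k → length (proj₂ (proj₁ (advance L c))) ≡ k
    one-less (_ , _ ◅ _) refl = refl

  tour-periodic : EventuallyPeriodic (Path.vertex tour)
  tour-periodic = k , d , λ j → cong proj₁ (same-cursor j)
    where
    k d : ℕ
    k = length (rest 0) ℕ.+ 0
    d = length (rest (suc k))
    same-cursor : ∀ j → cursor (j ℕ.+ (d ℕ.+ suc k)) ≡ cursor (j ℕ.+ k)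
    same-cursor zero    = trans (returns d (suc k) refl) (sym (returns (length (rest 0)) 0 refl))
    same-cursor (suc j) = cong (λ c → proj₁ (advance L c)) (same-cursor j)

module _ (em : ExcludedMiddle (lsuc 0ℓ)) {n : ℕ} {_⟶_ : Fin n → Fin n → Set}
  (w : Weighting _⟶_) where
  open FiniteGraph em

  short-walks-within : ∀ a b m →
    ∃[ C ] (∀ u v (γ : Star _⟶_ u v) → length γ ℕ.≤ m → Within a b C (length γ) (sum w γ))
  short-walks-within a b m = uniform-over-walks ℚ-directed 0ℚ w m
    {λ _ _ k W C → Within a b C k W} within-weaken (λ _ _ γ _ → within-exists (length γ) (sum w γ))

  short-walks-cancel : ∀ a b C m →
    ∃[ D ] (∀ u v (γ : Star _⟶_ u v) → length γ ℕ.≤ m →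
      ∀ {k W} → Within a b C (length γ ℕ.+ k) (sum w γ + W) → Within a b D k W)
  short-walks-cancel a b C m = uniform-over-walks ℚ-directed 0ℚ w m
    {λ _ _ l Wˡ D → ∀ {k W} → Within a b C (l ℕ.+ k) (Wˡ + W) → Within a b D k W}
    (λ D≤D′ cancel h → within-weaken D≤D′ (cancel h))
    (λ _ _ γ _ → let (D , cancel) = within-cancel (length γ) (sum w γ) in C + D , cancel)

  module _ {v : Fin n} (choose : ℕ → ℚ → Loop _⟶_ v) (start : Cursor _⟶_ v) where
    open Tour w choose start

    tour-within : ∀ {a b C m} → HoldsAfter {Within a b C} {m} 0 0ℚ (proj₂ start) →
      (∀ k W → Within a b C k W → HoldsAfter {Within a b C} {m} k W (proj₁ (choose k W))) →
      ∃[ D ] (∀ t → Within a b D t (partial-sum w tour t))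
    tour-within {a} {b} {C} {m} after-start after-choice =
      let (D , cancel) = short-walks-cancel a b C m
          within-travelled : ∀ t → Within a b D t (travelled t)
          within-travelled t = let (within , short) = tour-invariant after-start after-choice t in
            cancel _ _ (rest t) short (subst₂ (Within a b C)
              (ℕₚ.+-comm t (length (rest t))) (ℚₚ.+-comm (travelled t) (sum w (rest t))) within)
      in D , λ t → subst (Within a b D t) (sym (partial-sum-tour t)) (within-travelled t)

-- Controllers for Eve

Finite : Set → Set
Finite S = ∃[ n ] S ↪ Fin n

finite-Fin : ∀ n → Finite (Fin n)
finite-Fin n = n , ↪-id (Fin n)

finite-⊤ : Finite ⊤
finite-⊤ = 1 , ↔⇒↪ (↔-sym Finₚ.1↔⊤)

finite-× : ∀ {S T} → Finite S → Finite T → Finite (S × T)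
finite-× (m , f) (n , g) = m ℕ.* n , ↔⇒↪ (↔-sym Finₚ.*↔×) ↪-∘ (f ×-↪ g)

finite-⊎ : ∀ {S T} → Finite S → Finite T → Finite (S ⊎ T)
finite-⊎ (m , f) (n , g) = m ℕ.+ n , ↔⇒↪ (↔-sym Finₚ.+↔⊎) ↪-∘ (f ⊎-↪ g)

module Controllers (G : GameGraph) (I : Interval) where
  open GameGraph G

  owner : ∀ u → Owns G eve u ⊎ Owns G adam u
  owner u with V∃ u
  ... | true  = inj₁ refl
  ... | false = inj₂ refl

  ¬both-own : ∀ {u} → Owns G eve u → ¬ Owns G adam u
  ¬both-own is-eve is-adam = contradiction (trans (sym is-eve) is-adam) λ ()

  -- A set of moves contains u → v as combine u v and confines only Adam.
  Moves : Set
  Moves = Subset (order ℕ.* order)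

  Move : Moves → V → V → Set
  Move p u v = Σ[ _ ∈ Edge u v ] (Owns G adam u → combine u v ∈ p)

  edge-weight-unique : ∀ {u v} (e e′ : Edge u v) → fromℤ (w e) ≡ fromℤ (w e′)
  edge-weight-unique e e′ = cong (fromℤ ∘ w) (Boolₚ.T-irrelevant e e′)

  move-weight : ∀ {p} → Weighting (Move p)
  weigh        move-weight (e , _)          = fromℤ (w e)
  weigh-unique move-weight (e , _) (e′ , _) = edge-weight-unique e e′

  without : ∀ {p u u′ v y} → ¬ (u ≡ v × u′ ≡ y) → Move p u u′ → Move (p ∖ combine v y) u u′
  without {u = u} {u′} {v} {y} ≢vy (e , allowed) = e , λ is-adam →
    x∈p∧x≢y⇒x∈p-y (allowed is-adam) (≢vy ∘ Finₚ.combine-injective u u′ v y)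

  -- Unlike a Machine, a controller sees the current vertex besides its memory.
  record Controller : Set₁ where
    field
      Memory : Set
      init   : Memory
      update : Memory → V → V → Memory
      choose : Memory → (v : V) → ∃[ u ] Edge v u

  open Controller public

  data Run (p : Moves) (K : Controller) : Memory K → V → ℕ → ℚ → Set where
    initial : Run p K (init K) q₀ 0 0ℚ
    _then_chosen-by_ : ∀ {s u v k W} → Run p K s u k W → (m : Move p u v) →
      (Owns G eve u → v ≡ proj₁ (choose K s u)) →
      Run p K (update K s u v) v (suc k) (W + weigh move-weight m)

  record EveConfines (p : Moves) : Set₁ where
    field
      K      : Controller
      finite : NotIrrationalPoint I → Finite (Memory K)
      {a b}  : ℝ
      a∈I    : a ∈ᴵ I
      b∈I    : b ∈ᴵ I
      C      : ℚ
      within : ∀ {s v k W} → Run p K s v k W → Within a b C k W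

-- Combining controllers

module Shuffling (em : ExcludedMiddle (lsuc 0ℓ)) (G : GameGraph) (I : Interval) where
  open GameGraph G
  open Classical em
  open Controllers G I

  common-lower-end : ∀ {a a′} → a ∈ᴵ I → a′ ∈ᴵ I → Σ[ m ∈ ℝ ] (m ∈ᴵ I × m ≤ a × m ≤ a′)
  common-lower-end {a} {a′} a∈I a′∈I with ≤-total a a′
  ... | inj₁ a≤a′ = a , a∈I , (λ _ → id) , a≤a′
  ... | inj₂ a′≤a = a′ , a′∈I , a′≤a , (λ _ → id)

  common-upper-end : ∀ {b b′} → b ∈ᴵ I → b′ ∈ᴵ I → Σ[ m ∈ ℝ ] (m ∈ᴵ I × b ≤ m × b′ ≤ m)
  common-upper-end {b} {b′} b∈I b′∈I with ≤-total b b′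
  ... | inj₁ b≤b′ = b′ , b′∈I , b≤b′ , (λ _ → id)
  ... | inj₂ b′≤b = b , b∈I , (λ _ → id) , b′≤b

  Mode : Set
  Mode = Fin 2

  pattern first  = Fin.zero
  pattern second = Fin.suc Fin.zero

  module _ {p : Moves} {v u₁ u₂ : V} (v-adam : Owns G adam v) (u₁≢u₂ : u₁ ≢ u₂)
    (E₁ : EveConfines (p ∖ combine v u₂)) (E₂ : EveConfines (p ∖ combine v u₁)) where

    private
      p₁ p₂ : Moves
      p₁ = p ∖ combine v u₂
      p₂ = p ∖ combine v u₁
      module E₁ = EveConfines E₁
      module E₂ = EveConfines E₂
      K₁ K₂ : Controller
      K₁ = E₁.K
      K₂ = E₂.K

    avoids-v : ¬ (∃[ s ] ∃[ k ] ∃[ W ] Run p₂ K₂ s v k W) →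
      ∀ {s u k W} → Run p K₂ s u k W → Run p₂ K₂ s u k W
    avoids-v never initial = initial
    avoids-v never (r then m chosen-by obeys) =
      avoids-v never r
        then without (λ { (refl , _) → never (_ , _ , _ , avoids-v never r) }) m
        chosen-by obeys

    -- The excursion from v that starts with the given move belongs to the controller that allows it.
    mode-after : Mode → V → V → Mode
    mode-after m u u′ with u Finₚ.≟ v | u′ Finₚ.≟ u₂
    ... | no _  | _     = m
    ... | yes _ | yes _ = second
    ... | yes _ | no _  = first

    update-in : Mode → Memory K₁ × Memory K₂ → V → V → Memory K₁ × Memory K₂
    update-in first  (s₁ , s₂) u u′ = update K₁ s₁ u u′ , s₂
    update-in second (s₁ , s₂) u u′ = s₁ , update K₂ s₂ u u′

    choose-in : Mode → Memory K₁ × Memory K₂ → (u : V) → ∃[ u′ ] Edge u u′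
    choose-in first  (s₁ , _) = choose K₁ s₁
    choose-in second (_ , s₂) = choose K₂ s₂

    moves-in : Mode → Moves
    moves-in first  = p₁
    moves-in second = p₂

    shuffle-from : Memory K₂ → Controller
    shuffle-from s₂ = record
      { Memory = Mode × Memory K₁ × Memory K₂
      ; init   = first , init K₁ , s₂
      ; update = λ (m , s) u u′ → mode-after m u u′ , update-in (mode-after m u u′) s u u′
      ; choose = λ (m , s) → choose-in m s
      }

    module _ {s₀ : Memory K₂} {k₀ W₀} (visit : Run p₂ K₂ s₀ v k₀ W₀) where

      -- The play that is not being continued waits at v.
      position₁ position₂ : Mode → V → V
      position₁ first  u = u
      position₁ second u = v
      position₂ first  u = v
      position₂ second u = u

      -- The second play begins with the run that led to its visit of v: hence the offsets k₀ and W₀.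
      record Tracks (m : Mode) (s : Memory K₁ × Memory K₂) (u : V) (k : ℕ) (W : ℚ) : Set where
        field
          {k₁ k₂} : ℕ
          {W₁ W₂} : ℚ
          run₁    : Run p₁ K₁ (proj₁ s) (position₁ m u) k₁ W₁
          run₂    : Run p₂ K₂ (proj₂ s) (position₂ m u) k₂ W₂
          k-total : k₁ ℕ.+ k₂ ≡ k₀ ℕ.+ k
          W-total : W₁ + W₂ ≡ W₀ + W

      relabel-at-v : ∀ m m′ {s k W} → Tracks m s v k W → Tracks m′ s v k W
      relabel-at-v first  first  t = t
      relabel-at-v first  second t = record { Tracks t }
      relabel-at-v second first  t = record { Tracks t }
      relabel-at-v second second t = t

      switch : ∀ m {s u u′ k W} → Tracks m s u k W → Move p u u′ → let m′ = mode-after m u u′ in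
        Tracks m′ s u k W × Move (moves-in m′) u u′ × (Owns G eve u → m′ ≡ m)
      switch m {u = u} {u′} t e with u Finₚ.≟ v | u′ Finₚ.≟ u₂
      ... | yes refl | yes refl = relabel-at-v m second t , without (λ (_ , eq) → u₁≢u₂ (sym eq)) e ,
        λ is-eve → contradiction v-adam (¬both-own is-eve)
      ... | yes refl | no u′≢u₂ = relabel-at-v m first t , without (λ (_ , eq) → u′≢u₂ eq) e ,
        λ is-eve → contradiction v-adam (¬both-own is-eve)
      switch first  t e | no u≢v | _ = t , without (λ (eq , _) → u≢v eq) e , λ _ → refl
      switch second t e | no u≢v | _ = t , without (λ (eq , _) → u≢v eq) e , λ _ → refl

      extend : ∀ m {s u u′ k W} → Tracks m s u k W → (e : Move (moves-in m) u u′) →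
        (Owns G eve u → u′ ≡ proj₁ (choose-in m s u)) →
        Tracks m (update-in m s u u′) u′ (suc k) (W + weigh move-weight e)
      extend first {k = k} {W} t e obeys = record
        { run₁ = run₁ then e chosen-by obeys
        ; run₂ = run₂
        ; k-total = trans (cong suc k-total) (sym (ℕₚ.+-suc k₀ k))
        ; W-total = begin
            W₁ + z + W₂       ≡⟨ swap-last W₁ z W₂ ⟩
            W₁ + W₂ + z       ≡⟨ cong (_+ z) W-total ⟩
            W₀ + W + z        ≡⟨ ℚₚ.+-assoc W₀ W z ⟩
            W₀ + (W + z)      ∎ }
        where
        open Tracks t
        open ≡-Reasoning
        z : ℚ
        z = weigh move-weight e
        swap-last : ∀ a b c → a + b + c ≡ a + c + b
        swap-last = solve-∀ ℚ-ring
      extend second {k = k} {W} t e obeys = record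
        { run₁ = run₁
        ; run₂ = run₂ then e chosen-by obeys
        ; k-total = trans (ℕₚ.+-suc k₁ k₂) (trans (cong suc k-total) (sym (ℕₚ.+-suc k₀ k)))
        ; W-total = begin
            W₁ + (W₂ + z)     ≡⟨ ℚₚ.+-assoc W₁ W₂ z ⟨
            W₁ + W₂ + z       ≡⟨ cong (_+ z) W-total ⟩
            W₀ + W + z        ≡⟨ ℚₚ.+-assoc W₀ W z ⟩
            W₀ + (W + z)      ∎ }
        where
        open Tracks t
        open ≡-Reasoning
        z : ℚ
        z = weigh move-weight e

      tracks : ∀ {m s u k W} → Run p (shuffle-from s₀) (m , s) u k W → Tracks m s u k W
      tracks initial = record
        { run₁ = initial ; run₂ = visit
        ; k-total = sym (ℕₚ.+-identityʳ k₀)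
        ; W-total = trans (ℚₚ.+-identityˡ W₀) (sym (ℚₚ.+-identityʳ W₀)) }
      tracks (_then_chosen-by_ {s = m , s} {u} {u′} {k} {W} r e obeys) =
        let m′ = mode-after m u u′
            (t , e′ , same) = switch m (tracks r) e
        in subst (λ z → Tracks m′ (update-in m′ s u u′) u′ (suc k) (W + z))
             (edge-weight-unique (proj₁ e′) (proj₁ e))
             (extend m′ t e′ λ is-eve →
               trans (obeys is-eve) (cong (λ m → proj₁ (choose-in m s u)) (sym (same is-eve))))

      shuffle-visited : EveConfines p
      shuffle-visited with common-lower-end E₁.a∈I E₂.a∈I | common-upper-end E₁.b∈I E₂.b∈I
      ... | a , a∈I , a≤a₁ , a≤a₂ | b , b∈I , b₁≤b , b₂≤b = record
        { K      = shuffle-from s₀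
        ; finite = λ not-irrational →
            finite-× (finite-Fin 2) (finite-× (E₁.finite not-irrational) (E₂.finite not-irrational))
        ; a∈I    = a∈I
        ; b∈I    = b∈I
        ; C      = E₁.C + E₂.C + proj₁ (within-cancel {a} {b} k₀ W₀)
        ; within = λ r → combined (tracks r)
        }
        where
        combined : ∀ {m s u k W} → Tracks m s u k W → Within a b _ k W
        combined t = proj₂ (within-cancel {a} {b} k₀ W₀)
          (subst₂ (Within a b (E₁.C + E₂.C)) k-total W-total (within-+
            (within-widen a≤a₁ b₁≤b (E₁.within run₁)) (within-widen a≤a₂ b₂≤b (E₂.within run₂))))
          where open Tracks t

    shuffle : EveConfines p
    shuffle with em₀ (∃[ s ] ∃[ k ] ∃[ W ] Run p₂ K₂ s v k W)
    ... | yes (_ , _ , _ , visit) = shuffle-visited visit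
    ... | no never                = record { EveConfines E₂ ; within = E₂.within ∘ avoids-v never }

-- Games in which Adam has no choice

module ForcedGames (em : ExcludedMiddle (lsuc 0ℓ)) (G : GameGraph) (I : Interval) where
  open GameGraph G
  open Classical em
  open Controllers G I
  open FiniteGraph em using (light-cycle; heavy-cycle; GrowsAtLeast)

  Forced : Moves → Set
  Forced p = ∀ {u v v′} → Owns G adam u → Move p u v → Move p u v′ → v ≡ v′

  -- A clock tells the time up to moments from which the path continues in the same way.
  record Clock {p : Moves} (π : Path (Move p)) : Set₁ where
    open Path π
    field
      State       : Set
      origin      : State
      tick        : State → State
      time        : State → ℕ
      time-origin : time origin ≡ 0
      time-tick   : ∀ s j → vertex (j ℕ.+ time (tick s)) ≡ vertex (j ℕ.+ suc (time s))

  module _ {p : Moves} (π : Path (Move p)) where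
    open Path π

    counter : Clock π
    counter = record
      { State = ℕ ; origin = 0 ; tick = suc ; time = id ; time-origin = refl ; time-tick = λ _ _ → refl }

    lasso : EventuallyPeriodic vertex → Clock π
    lasso (k , d , periodic) = record
      { State = Fin (suc (d ℕ.+ k)) ; origin = Fin.zero ; tick = tick ; time = toℕ
      ; time-origin = refl ; time-tick = time-tick }
      where
      tick : Fin (suc (d ℕ.+ k)) → Fin (suc (d ℕ.+ k))
      tick i with suc (toℕ i) ℕₚ.<? suc (d ℕ.+ k)
      ... | yes i<d+k = fromℕ< i<d+k
      ... | no  _     = fromℕ< (ℕ.s≤s (ℕₚ.m≤n+m k d))

      time-tick : ∀ i j → vertex (j ℕ.+ toℕ (tick i)) ≡ vertex (j ℕ.+ suc (toℕ i))
      time-tick i j with suc (toℕ i) ℕₚ.<? suc (d ℕ.+ k)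
      ... | yes i<d+k = cong (λ t → vertex (j ℕ.+ t)) (Finₚ.toℕ-fromℕ< i<d+k)
      ... | no  i≮d+k = begin
        vertex (j ℕ.+ toℕ (fromℕ< (ℕ.s≤s (ℕₚ.m≤n+m k d))))
          ≡⟨ cong (λ t → vertex (j ℕ.+ t)) (Finₚ.toℕ-fromℕ< _) ⟩
        vertex (j ℕ.+ k)
          ≡⟨ periodic j ⟨
        vertex (j ℕ.+ (d ℕ.+ suc k))
          ≡⟨ cong (λ t → vertex (j ℕ.+ t)) last ⟩
        vertex (j ℕ.+ suc (toℕ i)) ∎
        where
        open ≡-Reasoning
        last : d ℕ.+ suc k ≡ suc (toℕ i)
        last = trans (ℕₚ.+-suc d k) (sym (ℕₚ.≤-antisym (Finₚ.toℕ<n i) (ℕₚ.≮⇒≥ i≮d+k)))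

    module Follow (forced : Forced p) (from-q₀ : vertex 0 ≡ q₀) (clock : Clock π) where
      open Clock clock

      successor : State → (v : V) → ∃[ u ] Edge v u
      successor s v with vertex (time s) Finₚ.≟ v
      ... | yes refl = vertex (suc (time s)) , proj₁ (step (time s))
      ... | no  _    = total v

      successor-on-path : ∀ s {v} → vertex (time s) ≡ v → proj₁ (successor s v) ≡ vertex (suc (time s))
      successor-on-path s {v} eq with vertex (time s) Finₚ.≟ v
      ... | yes refl = refl
      ... | no  ≢v   = contradiction eq ≢v

      follow : Controller
      follow = record { Memory = State ; init = origin ; update = λ s _ _ → tick s ; choose = successor }

      record OnPath (s : State) (u : V) (k : ℕ) (W : ℚ) : Set where
        field
          vertex≡ : u ≡ vertex k
          weight≡ : W ≡ partial-sum move-weight π k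
          in-time : ∀ j → vertex (j ℕ.+ time s) ≡ vertex (j ℕ.+ k)

      same-step : ∀ {u v k} (m : Move p u v) → u ≡ vertex k → v ≡ vertex (suc k) →
        weigh move-weight m ≡ weigh move-weight (step k)
      same-step {k = k} m refl refl = weigh-unique move-weight m (step k)

      run-on-path : ∀ {s u k W} → Run p follow s u k W → OnPath s u k W
      run-on-path initial = record
        { vertex≡ = sym from-q₀
        ; weight≡ = refl
        ; in-time = λ j → cong (λ t → vertex (j ℕ.+ t)) time-origin }
      run-on-path (_then_chosen-by_ {s} {u} {v} {k} r m obeys) = record
        { vertex≡ = v≡
        ; weight≡ = trans (cong₂ _+_ weight≡ (same-step m vertex≡ v≡))
            (sym (partial-sum-suc move-weight π k))
        ; in-time = next-in-time }
        where
        open OnPath (run-on-path r)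
        open ≡-Reasoning

        v≡ : v ≡ vertex (suc k)
        v≡ with owner u
        ... | inj₁ is-eve  = begin
          v                          ≡⟨ obeys is-eve ⟩
          proj₁ (successor s u)      ≡⟨ successor-on-path s (trans (in-time 0) (sym vertex≡)) ⟩
          vertex (suc (time s))      ≡⟨ in-time 1 ⟩
          vertex (suc k)             ∎
        ... | inj₂ is-adam =
          forced is-adam m (subst (λ u → Move p u (vertex (suc k))) (sym vertex≡) (step k))

        next-in-time : ∀ j → vertex (j ℕ.+ time (tick s)) ≡ vertex (j ℕ.+ suc k)
        next-in-time j = begin
          vertex (j ℕ.+ time (tick s))  ≡⟨ time-tick s j ⟩
          vertex (j ℕ.+ suc (time s))   ≡⟨ cong vertex (ℕₚ.+-suc j (time s)) ⟩
          vertex (suc j ℕ.+ time s)     ≡⟨ in-time (suc j) ⟩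
          vertex (suc j ℕ.+ k)          ≡⟨ cong vertex (ℕₚ.+-suc j k) ⟨
          vertex (j ℕ.+ suc k)          ∎

      follow-confines : (NotIrrationalPoint I → Finite State) → ∀ {c C} → c ∈ᴵ I →
        (∀ k → Within c c C k (partial-sum move-weight π k)) → EveConfines p
      follow-confines finite {c} {C} c∈I within = record
        { K = follow ; finite = finite ; a∈I = c∈I ; b∈I = c∈I ; C = C
        ; within = λ {_} {_} {k} r →
            subst (Within c c C k) (sym (OnPath.weight≡ (run-on-path r))) (within k) }

  module _ {p : Moves} (forced : Forced p) {v : V} (reach : Star (Move p) q₀ v) where

    tour-confines : ∀ {c C m} → c ∈ᴵ I → (choose-loop : ℕ → ℚ → Loop (Move p) v) →
      let open Tour move-weight choose-loop (q₀ , reach) in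
      Within c c C (length reach) (sum move-weight reach) → length reach ℕ.≤ m →
      (∀ k W → Within c c C k W → HoldsAfter {Within c c C} {m} k W (proj₁ (choose-loop k W))) →
      (clock : Clock tour) → (NotIrrationalPoint I → Finite (Clock.State clock)) → EveConfines p
    tour-confines {c} {C} c∈I choose-loop within short round clock finite =
      Follow.follow-confines tour forced refl clock finite c∈I
        (proj₂ (tour-within em move-weight choose-loop (q₀ , reach) (from-0 , short) round))
      where
      open Tour move-weight choose-loop (q₀ , reach)
      from-0 : Within c c C (length reach) (0ℚ + sum move-weight reach)
      from-0 = subst (Within c c C (length reach)) (sym (ℚₚ.+-identityˡ (sum move-weight reach))) within

    loop-confines : ∀ {c} → fromℚ c ∈ᴵ I → (γ : Star (Move p) v v) → 0 ℕ.< length γ →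
      c * fromℕ (length γ) ≡ sum move-weight γ → EveConfines p
    loop-confines {c} c∈I γ nonempty mean =
      let (C , within) = within-exists {fromℚ c} {fromℚ c} (length reach) (sum move-weight reach) in
      tour-confines {m = length reach ℕ.+ length γ} c∈I (λ _ _ → γ , nonempty) within (ℕₚ.m≤m+n _ _)
        (λ k W h → round h , ℕₚ.m≤n+m _ _)
        (lasso tour (tour-periodic move-weight (γ , nonempty) (q₀ , reach))) (λ _ → finite-Fin _)
      where
      open Tour move-weight (λ _ _ → γ , nonempty) (q₀ , reach) using (tour)
      round : ∀ {C k W} → Within (fromℚ c) (fromℚ c) C k W →
        Within (fromℚ c) (fromℚ c) C (k ℕ.+ length γ) (W + sum move-weight γ)
      round {C} h = within-weaken (ℚₚ.≤-reflexive (ℚₚ.+-identityʳ C)) (within-+ h (within-mean mean))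

    module _ {c : ℝ} (c∈I : c ∈ᴵ I) (irrational : ¬ NotIrrationalPoint I) {γ δ : Star (Move p) v v}
      (γ-nonempty : 0 ℕ.< length γ) (γ-below : Below c 0ℚ (length γ) (sum move-weight γ))
      (δ-nonempty : 0 ℕ.< length δ) (δ-above : Above c 0ℚ (length δ) (sum move-weight δ)) where

      -- Taking γ when W ≥ c · k, and δ otherwise, keeps W - c · k bounded.
      greedy-loop : ∀ {k W} → Dec (Above c 0ℚ k W) → Loop (Move p) v
      greedy-loop (yes _) = γ , γ-nonempty
      greedy-loop (no  _) = δ , δ-nonempty

      longest : ℕ
      longest = length reach ℕ.⊔ (length γ ℕ.⊔ length δ)

      γ≤longest : length γ ℕ.≤ longest
      γ≤longest = ℕₚ.≤-trans (ℕₚ.m≤m⊔n (length γ) (length δ)) (ℕₚ.m≤n⊔m (length reach) _)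

      δ≤longest : length δ ℕ.≤ longest
      δ≤longest = ℕₚ.≤-trans (ℕₚ.m≤n⊔m (length γ) (length δ)) (ℕₚ.m≤n⊔m (length reach) _)

      greedy-within : ∀ {C} → Within c c C (length γ) (sum move-weight γ) →
        Within c c C (length δ) (sum move-weight δ) →
        ∀ {k W} → Within c c C k W → (d : Dec (Above c 0ℚ k W)) → let (ζ , _) = greedy-loop d in
        Within c c C (k ℕ.+ length ζ) (W + sum move-weight ζ) × length ζ ℕ.≤ longest
      greedy-within {C} γ-within _ {W = W} (_ , W-below) (yes W-above) =
        (above-weaken (ℚₚ.≤-reflexive (ℚₚ.+-identityˡ C)) (above-+ W-above (is-above γ-within)) ,
         above-weaken (ℚₚ.≤-reflexive (ℚₚ.+-identityʳ C)) (below-+ c {W = W} W-below γ-below)) ,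
        γ≤longest
      greedy-within {C} _ δ-within {W = W} (W-above , _) (no ¬W-above) =
        (above-weaken (ℚₚ.≤-reflexive (ℚₚ.+-identityʳ C)) (above-+ W-above δ-above) ,
         above-weaken (ℚₚ.≤-reflexive (ℚₚ.+-identityˡ C))
           (below-+ c {W = W} (¬above⇒below c ¬W-above) (is-below δ-within))) ,
        δ≤longest

      greedy-tour-confines : EveConfines p
      greedy-tour-confines =
        let (C , within) = short-walks-within em move-weight c c longest in
        tour-confines {m = longest} c∈I (λ k W → greedy-loop (em₀ (Above c 0ℚ k W)))
          (within _ _ reach (ℕₚ.m≤m⊔n _ _)) (ℕₚ.m≤m⊔n _ _)
          (λ k W h → greedy-within (within _ _ γ γ≤longest) (within _ _ δ δ≤longest) h
            (em₀ (Above c 0ℚ k W)))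
          (counter _) (λ not-irrational → contradiction not-irrational irrational)

  module _ {p : Moves} (forced : Forced p) {v : V} (reach : Star (Move p) q₀ v) where

    cycle-confines : ∀ {μ} → fromℚ μ ∈ᴵ I → Cycle move-weight v μ → EveConfines p
    cycle-confines μ∈I cycle = loop-confines forced (reach ◅◅ proj₁ connected) μ∈I loop nonempty mean
      where open Cycle cycle

    balance-confines : ∀ {c μ ν} → fromℚ c ∈ᴵ I → Cycle move-weight v μ → μ ℚ.< c →
      Cycle move-weight v ν → c ℚ.< ν → EveConfines p
    balance-confines {c} c∈I light μ<c heavy c<ν =
      let (γ , negative)             = cycle⇒light-walk light μ<c
          (δ , positive)             = cycle⇒heavy-walk heavy c<ν
          (ζ , nonempty , balanced)  = balance (shift c move-weight) γ δ negative positive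
      in loop-confines forced reach c∈I ζ nonempty
           (sym (x∙y⁻¹≈ε⇒x≈y _ _ (trans (sym (sum-shift c move-weight ζ)) balanced)))

    straddle-confines : ∀ {x μ ν} → x ∈ᴵ I → ¬ NotIrrationalPoint I →
      Cycle move-weight v μ → fromℚ μ < x → Cycle move-weight v ν → x < fromℚ ν → EveConfines p
    straddle-confines {x} x∈I irrational light (q , μ<q , q<x) heavy (r , x<r , r<ν) =
      let (γ , negative) = cycle⇒light-walk light μ<q
          (δ , positive) = cycle⇒heavy-walk heavy r<ν
      in greedy-tour-confines forced reach x∈I irrational
           (sum-≢0⇒nonempty (shift q move-weight) γ (ℚₚ.<⇒≢ negative))
           (light⇒below move-weight x γ q<x (ℚₚ.<⇒≤ negative))
           (sum-≢0⇒nonempty (shift r move-weight) δ (ℚₚ.<⇒≢ positive ∘ sym))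
           (heavy⇒above move-weight x δ x<r (ℚₚ.<⇒≤ positive))

    confines-between : ∀ {x μ ν} → x ∈ᴵ I → fromℚ μ ≤ x → Cycle move-weight v μ →
      x ≤ fromℚ ν → Cycle move-weight v ν → EveConfines p
    confines-between {x} {μ} {ν} x∈I μ≤x light x≤ν heavy
      with em₀ (fromℚ μ ∈ᴵ I) | em₀ (fromℚ ν ∈ᴵ I) | em {NotIrrationalPoint I}
    ... | yes μ∈I | _       | _ = cycle-confines μ∈I light
    ... | _       | yes ν∈I | _ = cycle-confines ν∈I heavy
    ... | no μ∉I  | no ν∉I  | yes not-irrational =
      let (c , c∈I) = rational-member not-irrational x∈I in
      balance-confines c∈I
        light (ℚₚ.≰⇒> λ c≤μ → μ∉I (∈ᴵ-convex I c∈I x∈I (fromℚ-mono-≤ c≤μ) μ≤x))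
        heavy (ℚₚ.≰⇒> λ ν≤c → ν∉I (∈ᴵ-convex I x∈I c∈I x≤ν (fromℚ-mono-≤ ν≤c)))
    ... | no μ∉I  | no ν∉I  | no irrational with ≤-or-> x (fromℚ μ) | ≤-or-> (fromℚ ν) x
    ...   | inj₁ x≤μ | _        = contradiction (∈ᴵ-convex I x∈I x∈I x≤μ μ≤x) μ∉I
    ...   | _        | inj₁ ν≤x = contradiction (∈ᴵ-convex I x∈I x∈I x≤ν ν≤x) ν∉I
    ...   | inj₂ μ<x | inj₂ x<ν = straddle-confines x∈I irrational light μ<x heavy x<ν

  AdamMovesIn : Moves → Play G → Set
  AdamMovesIn p π = ∀ t → Owns G adam (vertex t) → combine (vertex t) (vertex (suc t)) ∈ p
    where open Play π

  module _ {p : Moves} (forced : Forced p) (π : Play G) (allowed : AdamMovesIn p π) where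
    open Play π

    path : Path (Move p)
    path = record { vertex = vertex ; step = λ t → step t , allowed t }

    partial-sum-path : ∀ k → partial-sum move-weight path k ≡ fromℤ (weight G π k)
    partial-sum-path zero    = refl
    partial-sum-path (suc k) = begin
      partial-sum move-weight path (suc k)              ≡⟨ partial-sum-suc move-weight path k ⟩
      partial-sum move-weight path k + fromℤ z          ≡⟨ cong (_+ fromℤ z) (partial-sum-path k) ⟩
      fromℤ (weight G π k) + fromℤ z                    ≡⟨ fromℤ-+ (weight G π k) z ⟨
      fromℤ (weight G π (suc k))                        ∎
      where
      open ≡-Reasoning
      z : ℤ
      z = w (step k)

    module _ {x : ℝ} (payoff : IsMeanPayoff G π x) where

      grows-no-faster : ∀ {q} → upper x q → ¬ GrowsAtLeast q move-weight path
      grows-no-faster {q} x<q (C , N , grows) =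
        upper⇒≰ x x<q (above⇒≤liminf (weight G π) C N (fromℚ q) x payoff λ k N≤k →
          above-fromℚ {q} (subst (λ W → q * fromℕ k ℚ.≤ W + C) (partial-sum-path k) (grows k N≤k)))

      grows-no-slower : ∀ {q} → lower x (- q) → ¬ GrowsAtLeast q (negate move-weight) path
      grows-no-slower {q} -q<x (C , N , shrinks) =
        lower⇒≱ x -q<x (below⇒liminf≤ (weight G π) C N (fromℚ (- q)) x payoff λ k N≤k →
          above-antitone neg-fromℚ-neg-≤ (above-fromℚ {q}
            (subst (λ W → q * fromℕ k ℚ.≤ W + C) (negated-sum k) (shrinks k N≤k))))
        where
        negated-sum : ∀ k → partial-sum (negate move-weight) path k ≡ - fromℤ (weight G π k)
        negated-sum k =
          trans (sum-negate move-weight (initial-walk path k)) (cong -_ (partial-sum-path k))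

        neg-fromℚ-neg-≤ : neg (fromℚ (- q)) ≤ fromℚ q
        neg-fromℚ-neg-≤ r = subst (r ℚ.<_) (neg-involutive q) ∘ p<-q⇒q<-p

      forced-confines : x ∈ᴵ I → EveConfines p
      forced-confines x∈I =
        let (N , recurrent)   = recurrent-exists em vertex
            (μ , μ≤x , light) = light-cycle move-weight path {N} recurrent x grows-no-faster
            (ν , x≤ν , heavy) = heavy-cycle move-weight path {N} recurrent x grows-no-slower
            reach             = subst (λ u → Star (Move p) u (vertex N)) starts (initial-walk path N)
        in confines-between forced reach x∈I μ≤x light x≤ν heavy

-- Strategies from controllers

module Strategies (em : ExcludedMiddle (lsuc 0ℓ)) (G : GameGraph) (I : Interval) where
  open GameGraph G
  open Classical em
  open Controllers G I

  module _ {T : Set} (t₀ : T) (next : T → V → T) where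

    state : ∀ {v} → Prefix G v → T
    state {v} (start _) = next t₀ v
    state {v} (h ▷ _)   = next (state h) v

    module _ (finite : Finite T) (out : T → V) where
      open RightInverse (proj₂ finite)

      machine : Machine G
      machine = record
        { size    = proj₁ finite
        ; initial = to t₀
        ; update  = λ i v → to (next (from i) v)
        ; output  = λ i → out (from i)
        }

      from-run-machine : ∀ {v} (h : Prefix G v) → from (run G machine h) ≡ state h
      from-run-machine {v} (start _) =
        trans (strictlyInverseʳ _) (cong (λ t → next t v) (strictlyInverseʳ t₀))
      from-run-machine {v} (h ▷ _)   =
        trans (strictlyInverseʳ _) (cong (λ t → next t v) (from-run-machine h))

      finite-state⇒finite-memory : ∀ P (σ : Strategy G P) →
        (∀ {v} (h : Prefix G v) (o : Owns G P v) → proj₁ (σ h o) ≡ out (state h)) → FiniteMemory G {P} σ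
      finite-state⇒finite-memory P σ σ≡out = machine , λ h o →
        trans (σ≡out h o) (sym (cong out (from-run-machine h)))

  module _ (K : Controller) where

    memory : ∀ {v} → Prefix G v → Memory K
    memory (start _)         = init K
    memory (_▷_ {u} {v} h _) = update K (memory h) u v

    strategy : Strategy G eve
    strategy {v} h _ = choose K (memory h) v

    strategy-finite-memory : Finite (Memory K) → FiniteMemory G {eve} strategy
    strategy-finite-memory finite = finite-state⇒finite-memory (inj₁ tt) next
      (finite-⊎ finite-⊤ (finite-× finite (finite-Fin order))) out eve strategy
      λ h _ → sym (cong out (state-memory h))
      where
      next : ⊤ ⊎ (Memory K × V) → V → ⊤ ⊎ (Memory K × V)
      next (inj₁ tt)      v = inj₂ (init K , v)
      next (inj₂ (s , u)) v = inj₂ (update K s u v , v)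

      out : ⊤ ⊎ (Memory K × V) → V
      out (inj₁ tt)      = q₀
      out (inj₂ (s , u)) = proj₁ (choose K s u)

      state-memory : ∀ {v} (h : Prefix G v) → state (inj₁ tt) next h ≡ inj₂ (memory h , v)
      state-memory     (start _) = refl
      state-memory {v} (h ▷ _)   = cong (λ t → next t v) (state-memory h)

    run-of : ∀ π → Consistent G {eve} strategy π → ∀ k →
      Run full K (memory (prefix G π k)) (Play.vertex π k) k (fromℤ (weight G π k))
    run-of π consistent zero    = subst (λ v → Run full K (init K) v 0 0ℚ) (sym (Play.starts π)) initial
    run-of π consistent (suc k) = subst (Run full K _ _ (suc k))
      (sym (fromℤ-+ (weight G π k) (w (Play.step π k))))
      (run-of π consistent k then (Play.step π k , λ _ → ∈⊤) chosen-by consistent k)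

  confines⇒winning : (E : EveConfines full) → Winning G I {eve} (strategy (EveConfines.K E))
  confines⇒winning E π consistent =
    let (x , payoff , a≤x , x≤b) = within⇒liminf λ k → within (run-of K π consistent k) in
    x , payoff , ∈ᴵ-convex I a∈I b∈I a≤x x≤b
    where open EveConfines E

  module _ (σ : Strategy G adam) (τ : Strategy G eve) where

    reply : ∀ {v} → Prefix G v → ∃[ u ] Edge v u
    reply {v} h with owner v
    ... | inj₁ is-eve  = τ h is-eve
    ... | inj₂ is-adam = σ h is-adam

    history : ℕ → ∃[ v ] Prefix G v
    history zero    = q₀ , start refl
    history (suc k) = let (v , h) = history k ; (u , e) = reply h in u , h ▷ e

    outcome : Play G
    outcome = record
      { vertex = λ k → proj₁ (history k)
      ; starts = refl
      ; step   = λ k → proj₂ (reply (proj₂ (history k))) }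

    prefix-outcome : ∀ k → prefix G outcome k ≡ proj₂ (history k)
    prefix-outcome zero    = refl
    prefix-outcome (suc k) = cong (_▷ Play.step outcome k) (prefix-outcome k)

    outcome-consistent-eve : Consistent G {eve} τ outcome
    outcome-consistent-eve k o rewrite prefix-outcome k with history k
    ... | v , h with owner v
    ...   | inj₁ is-eve  = cong (λ o → proj₁ (τ h o)) (≡-irrelevant is-eve o)
    ...   | inj₂ is-adam = contradiction is-adam (¬both-own o)

    outcome-consistent-adam : Consistent G {adam} σ outcome
    outcome-consistent-adam k o rewrite prefix-outcome k with history k
    ... | v , h with owner v
    ...   | inj₁ is-eve  = contradiction o (¬both-own is-eve)
    ...   | inj₂ is-adam = cong (λ o → proj₁ (σ h o)) (≡-irrelevant is-adam o)

    ¬both-winning : Winning G I {adam} σ → ¬ Winning G I {eve} τ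
    ¬both-winning σ-wins τ-wins =
      σ-wins outcome outcome-consistent-adam (τ-wins outcome outcome-consistent-eve)

-- Determinacy

module Determinacy (em : ExcludedMiddle (lsuc 0ℓ)) (G : GameGraph) (I : Interval) where
  open GameGraph G
  open Classical em
  open Controllers G I
  open ForcedGames em G I
  open Shuffling em G I

  AdamWinsPositionally : Set₁
  AdamWinsPositionally = Σ[ σ ∈ Strategy G adam ] (Positional G {adam} σ × Winning G I {adam} σ)

  Unblocked : Moves → Set
  Unblocked p = ∀ u → Owns G adam u → ∃[ v ] (Edge u v × combine u v ∈ p)

  forced-dichotomy : ∀ {p} → Forced p → Unblocked p → AdamWinsPositionally ⊎ EveConfines p
  forced-dichotomy {p} forced unblocked = answer em
    where
    move : ∀ v → ∃[ u ] Move p v u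
    move v with owner v
    ... | inj₁ is-eve  = let (u , e) = total v in
      u , e , λ is-adam → contradiction is-adam (¬both-own is-eve)
    ... | inj₂ is-adam = let (u , e , u∈p) = unblocked v is-adam in
      u , e , λ _ → u∈p

    σ : Strategy G adam
    σ {v} _ _ = let (u , e , _) = move v in u , e

    allowed : ∀ π → Consistent G {adam} σ π → AdamMovesIn p π
    allowed π consistent t is-adam = subst (λ u → combine (vertex t) u ∈ p) (sym (consistent t is-adam))
      (proj₂ (proj₂ (move (vertex t))) is-adam)
      where open Play π

    answer : Dec (Σ[ π ∈ Play G ] (Consistent G {adam} σ π × WonBy G I eve π)) →
      AdamWinsPositionally ⊎ EveConfines p
    answer (no ∄play) = inj₁
      (σ , ((λ v → proj₁ (move v)) , λ _ _ → refl) , λ π consistent won → ∄play (π , consistent , won))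
    answer (yes (π , consistent , x , payoff , x∈I)) =
      inj₂ (forced-confines forced π (allowed π consistent) payoff x∈I)

  unblocked-without : ∀ {p v y y′} → Unblocked p → Edge v y → combine v y ∈ p → y ≢ y′ →
    Unblocked (p ∖ combine v y′)
  unblocked-without {v = v} {y} {y′} unblocked e y∈p y≢y′ u is-adam with u Finₚ.≟ v
  ... | yes refl = y , e , x∈p∧x≢y⇒x∈p-y y∈p (y≢y′ ∘ Finₚ.combine-injectiveʳ v y v y′)
  ... | no u≢v   = let (x , e , x∈p) = unblocked u is-adam in
    x , e , x∈p∧x≢y⇒x∈p-y x∈p (u≢v ∘ Finₚ.combine-injectiveˡ u x v y′)

  dichotomy : ∀ p → Acc _⊂_ p → Unblocked p → AdamWinsPositionally ⊎ EveConfines p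
  dichotomy p (acc smaller) unblocked with em₀ (∃[ v ] ∃[ u₁ ] ∃[ u₂ ] (Owns G adam v × u₁ ≢ u₂ ×
    (Edge v u₁ × combine v u₁ ∈ p) × (Edge v u₂ × combine v u₂ ∈ p)))
  ... | no no-choice = forced-dichotomy (λ {u} {x} {y} → forced {u} {x} {y}) unblocked
    where
    forced : Forced p
    forced {u} {x} {y} is-adam (e , allowed) (e′ , allowed′) = decidable-stable (x Finₚ.≟ y) λ x≢y →
      no-choice (u , x , y , is-adam , x≢y , (e , allowed is-adam) , (e′ , allowed′ is-adam))
  ... | yes (v , u₁ , u₂ , is-adam , u₁≢u₂ , (e₁ , u₁∈p) , (e₂ , u₂∈p))
    with dichotomy (p ∖ combine v u₂) (smaller (x∈p⇒p-x⊂p u₂∈p))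
           (unblocked-without unblocked e₁ u₁∈p u₁≢u₂)
       | dichotomy (p ∖ combine v u₁) (smaller (x∈p⇒p-x⊂p u₁∈p))
           (unblocked-without unblocked e₂ u₂∈p (u₁≢u₂ ∘ sym))
  ...   | inj₁ adam-wins | _              = inj₁ adam-wins
  ...   | inj₂ _         | inj₁ adam-wins = inj₁ adam-wins
  ...   | inj₂ E₁        | inj₂ E₂        = inj₂ (shuffle is-adam u₁≢u₂ E₁ E₂)

  determinacy : AdamWinsPositionally ⊎ EveConfines full
  determinacy = dichotomy full (⊂-wellFounded full) λ u _ → let (v , e) = total u in v , e , ∈⊤

mainTheorem7 : ExcludedMiddle (lsuc 0ℓ) → (G : GameGraph) (I : Interval) →
    ( (Σ[ σ ∈ Strategy G adam ] Winning G I {adam} σ) →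
      Σ[ σ ∈ Strategy G adam ] (Positional G {adam} σ × Winning G I {adam} σ) )
    ×
    ( NotIrrationalPoint I →
      (Σ[ σ ∈ Strategy G eve ] Winning G I {eve} σ) →
      Σ[ σ ∈ Strategy G eve ] (FiniteMemory G {eve} σ × Winning G I {eve} σ) )
mainTheorem7 em G I with Determinacy.determinacy em G I
... | inj₁ (σ , positional , σ-wins) =
  (λ _ → σ , positional , σ-wins) ,
  (λ _ (τ , τ-wins) → contradiction τ-wins (¬both-winning σ τ σ-wins))
  where open Strategies em G I
... | inj₂ E =
  (λ (σ , σ-wins) → contradiction (confines⇒winning E) (¬both-winning σ (strategy K) σ-wins)) ,
  (λ not-irrational _ →
    strategy K , strategy-finite-memory K (finite not-irrational) , confines⇒winning E)
  where
  open Strategies em G I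
  open Controllers.EveConfines E
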